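{- Let $m,n$ be positive integers with $n$ even. Then the bar visibility number of the complete bipartite graph $K_{m,n}$ satisfies $b(K_{m,n})=\left\lceil \frac{mn+4}{2m+2n}\right\rceil$.
   Context: A bar is a horizontal line segment in the plane. A $t$-bar visibility representation of a graph $G$ assigns to each vertex of $G$ at most $t$ pairwise disjoint bars so that two vertices are adjacent if and only if some bar assigned to one of them sees some bar assigned to the other, where two bars see each other if there is an unobstructed vertical channel of positive width between them (an axis-parallel rectangle of positive width with bottom side in one bar, top side in the other, and interior meeting no other bar). The bar visibility number $b(G)$ is the least $t$ such that $G$ has a $t$-bar visibility representation.
   Formalization: The bars and the visibility channels have rational instead of real coordinates, so the minimality of the bar visibility number is asserted among representations with rational coordinates. -}

module Defs where

open import Data.Nat as ℕ using (ℕ; zero; suc; _+_; _*_)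
open import Data.Nat.DivMod using (_/_)
open import Data.Fin using (Fin)
open import Data.List using (List; length; lookup)
open import Data.Rational as ℚ using (ℚ)
open import Data.Product using (Σ; ∃; ∃-syntax; _×_; _,_)
open import Data.Sum using (_⊎_; inj₁; inj₂)
open import Data.Empty using (⊥)
open import Data.Unit using (⊤)
open import Relation.Nullary using (¬_)
open import Relation.Binary.PropositionalEquality using (_≡_)

-- Bars: horizontal closed segments {(x , y) | l ≤ x ≤ r} of positive
-- length, with rational coordinates.

record Bar : Set where
  constructor bar
  field
    y   : ℚ
    l   : ℚ
    r   : ℚ
    l<r : l ℚ.< r
open Bar public

Disjoint : Bar → Bar → Set
Disjoint a b = ¬ (y a ≡ y b) ⊎ (r a ℚ.< l b ⊎ r b ℚ.< l a)

record Graph : Set₁ where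
  field
    V   : Set
    Adj : V → V → Set
open Graph public

K : ℕ → ℕ → Graph
K m n = record { V = Fin m ⊎ Fin n ; Adj = adj }
  where
  adj : Fin m ⊎ Fin n → Fin m ⊎ Fin n → Set
  adj (inj₁ _) (inj₂ _) = ⊤
  adj (inj₂ _) (inj₁ _) = ⊤
  adj (inj₁ _) (inj₁ _) = ⊥
  adj (inj₂ _) (inj₂ _) = ⊥

module _ (G : Graph) where

  record BarRep (t : ℕ) : Set where
    field
      bars    : V G → List Bar
      atMostT : ∀ v → length (bars v) ℕ.≤ t

    Idx : Set
    Idx = Σ (V G) (λ v → Fin (length (bars v)))

    barOf : Idx → Bar
    barOf (v , i) = lookup (bars v) i

    -- bar a lies below bar b and they see each other: there is a
    -- rectangle [x₁,x₂] × [y a , y b] with x₁ < x₂, bottom side in a,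
    -- top side in b, whose interior (x₁,x₂) × (y a , y b) meets no
    -- other bar.
    SeesUp : Idx → Idx → Set
    SeesUp a b =
      y (barOf a) ℚ.< y (barOf b) ×
      ∃[ x₁ ] ∃[ x₂ ]
        (x₁ ℚ.< x₂ ×
         l (barOf a) ℚ.≤ x₁ × x₂ ℚ.≤ r (barOf a) ×
         l (barOf b) ℚ.≤ x₁ × x₂ ℚ.≤ r (barOf b) ×
         (∀ (c : Idx) →
            ¬ (y (barOf a) ℚ.< y (barOf c) × y (barOf c) ℚ.< y (barOf b) ×
               l (barOf c) ℚ.< x₂ × x₁ ℚ.< r (barOf c))))

    Sees : Idx → Idx → Set
    Sees a b = SeesUp a b ⊎ SeesUp b a

    field
      disjoint : ∀ (a b : Idx) → ¬ (a ≡ b) → Disjoint (barOf a) (barOf b)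
      adj⇒sees : ∀ v w → ¬ (v ≡ w) → Adj G v w →
                 ∃[ i ] ∃[ j ] Sees (v , i) (w , j)
      sees⇒adj : ∀ v w → ¬ (v ≡ w) → (i : Fin (length (bars v)))
                 (j : Fin (length (bars w))) → Sees (v , i) (w , j) → Adj G v w

  BarVisibilityNumber : ℕ → Set
  BarVisibilityNumber t = BarRep t × (∀ s → BarRep s → t ℕ.≤ s)

⌈_/_⌉ : ℕ → ℕ → ℕ
⌈ a / zero ⌉ = 0
⌈ a / suc b ⌉ = (a + b) / suc b

module Submission where

-- Lower bound. Sweep a vertical line from left to right. The bars on it, read upwards, form a
-- sequence, and every edge shows up as two consecutive entries. Inserting or deleting v between u
-- and w changes the pairs uv, vw, uw only, and at most two of these are edges of a bipartite graph;
-- hence twice the number of edges created so far, minus the number of edges present, grows by at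
-- most 2 at each of the 2N ends of the N bars. As 6 is saved when fewer than two bars are present,
-- at most 2N − 3 edges are created. So mn + 3 ≤ 2t(m + n), and as mn is even, mn + 4 ≤ 2t(m + n).
--
-- Upper bound. Group the n = 2s vertices of Y into s pairs. The bars of X form a sequence, bar h
-- belonging to the vertex h mod m. Let a = m − 2t > 0 (if a ≤ 0, a single block will do). The block of
-- a pair is nested between two consecutive bars d and d + 1, touches both, and encloses and touches
-- the next a bars d + 2, …, d + a + 1; the bars d + a and d + a + 1 then enclose the next block. The
-- outermost block encloses a + 2 bars (or m, if s is small). Any two consecutive bars p and p + 1
-- bound a zone in which copies of pairs can be drawn side by side, each touching exactly these two
-- bars. The 2t − 2 vertices that the block of a pair misses are cyclically consecutive, so t − 1 such
-- copies reach them.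

open import Defs
open import Data.Bool using (Bool; true; false; not)
open import Data.Bool.Properties using (not-involutive)
open import Data.Empty using (⊥-elim)
open import Data.Fin as Fin using (Fin; zero; suc; toℕ; combine; remQuot)
import Data.Fin.Properties as Finₚ
open import Data.Integer as ℤ using (+≤+; +<+)
import Data.Integer.Properties as ℤₚ
open import Data.List using (List; []; _∷_; _++_; length; map; concatMap; filter; reverse; lookup; allFin; tabulate)
open import Data.List.Membership.Propositional using (_∈_; _∉_)
open import Data.List.Membership.Propositional.Properties
  using (∈-++⁺ˡ; ∈-++⁺ʳ; ∈-++⁻; ∈-map⁺; ∈-map⁻; ∈-concatMap⁺; ∈-filter⁺; ∈-filter⁻; ∈-allFin)
open import Data.List.Properties
open import Data.List.Relation.Binary.Permutation.Propositional using (↭-sym)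
open import Data.List.Relation.Binary.Permutation.Propositional.Properties using (∈-resp-↭; ↭-length)
open import Data.List.Relation.Binary.Subset.Propositional using (_⊆_)
open import Data.List.Relation.Unary.All as All using (All; []; _∷_)
import Data.List.Relation.Unary.All.Properties as Allₚ
open import Data.List.Relation.Unary.AllPairs using (AllPairs; []; _∷_)
open import Data.List.Relation.Unary.Any as Any using (here; there)
open import Data.List.Relation.Unary.Any.Properties using (lookup-index)
open import Data.List.Relation.Unary.Linked as Linked using (Linked; []; [-]; _∷_)
import Data.List.Relation.Unary.Linked.Properties as Linkedₚ
open import Data.List.Relation.Unary.Sorted.TotalOrder.Properties using (Sorted⇒AllPairs)
open import Data.List.Relation.Unary.Unique.Propositional using (Unique)
import Data.List.Relation.Unary.Unique.Propositional.Properties as Uniqueₚ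
import Data.List.Sort as Sort
open import Data.Nat
open import Data.Nat.Coprimality using (1-coprimeTo) renaming (sym to coprime-sym)
open import Data.Nat.Divisibility using (_∣_; divides)
open import Data.Nat.DivMod
  using (_mod_; m≡m%n+[m/n]*n; m%n<n; [m+n]%n≡m%n; m<n⇒m%n≡m; %-distribˡ-+; m%n%n≡m%n; m<n*o⇒m/o<n)
open import Data.Nat.Properties
open import Data.Nat.Tactic.RingSolver using (solve-∀)
open import Data.Product using (Σ; ∃-syntax; _×_; _,_; proj₁; proj₂)
open import Data.Rational as ℚ using (ℚ; mkℚ; *≤*; *<*)
import Data.Rational.Properties as ℚₚ
open import Data.Sum as Sum using (_⊎_; inj₁; inj₂)
import Data.Sum.Properties as Sumₚ
open import Data.Unit using (tt)
open import Relation.Binary.Bundles using (DecTotalOrder)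
import Relation.Binary.Construct.On as On
open import Relation.Binary.Definitions using (tri<; tri≈; tri>)
open import Relation.Binary.PropositionalEquality
open import Relation.Nullary
open import Relation.Nullary.Decidable using (_×-dec_; ¬?)

-- Edges created by a sweep

-- The parameters come from an exact count. A vertex of Y gets one bar from its block and t - 1
-- copies; the block touches a + 2 bars of X and the copies touch 2(t - 1), which makes m when a = m
-- - 2t. The bars 0 and 1 around the outermost block are not drawn, so this block encloses two more
-- than the others in order to touch a + 2 bars as well. Hence s blocks use as + 2 bars of X, while
-- t bars for each vertex allow tm; and as + 2 ≤ tm is the same as ms + 2 ≤ t(m + 2s), which is half
-- of mn + 4 ≤ 2t(m + n). In both directions the geometry is reduced to lists of labels read upwards
-- along a vertical line, in which visibility means being consecutive. In the construction all ends
-- of bars are integers, so one list for each unit column suffices, and no unwanted edge arises if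
-- every list alternates between X and Y.

module _ {m n : ℕ} where

  edge : Fin m ⊎ Fin n → Fin m ⊎ Fin n → List (Fin m × Fin n)
  edge (inj₁ x) (inj₂ y) = (x , y) ∷ []
  edge (inj₂ y) (inj₁ x) = (x , y) ∷ []
  edge _        _        = []

  -- The junction of `P` and `Q`, kept as a list so that lengths and membership in `path` need no
  -- separate case when one side is empty.
  link : List (Fin m ⊎ Fin n) → List (Fin m ⊎ Fin n) → List (Fin m × Fin n)
  link []           Q       = []
  link (u ∷ [])     []      = []
  link (u ∷ [])     (w ∷ _) = edge u w
  link (_ ∷ u ∷ P)  Q       = link (u ∷ P) Q

  path : List (Fin m ⊎ Fin n) → List (Fin m × Fin n)
  path []      = []
  path (v ∷ L) = link (v ∷ []) L ++ path L

  path-++ : ∀ P Q → path (P ++ Q) ≡ path P ++ link P Q ++ path Q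
  path-++ []          Q       = refl
  path-++ (u ∷ [])    []      = refl
  path-++ (u ∷ [])    (w ∷ Q) = refl
  path-++ (u ∷ v ∷ P) Q       =
    trans (cong (edge u v ++_) (path-++ (v ∷ P) Q)) (sym (++-assoc (edge u v) _ _))

  -- The three edges would form a triangle in a bipartite graph.
  edge-triangle : ∀ u v w → length (edge u v) + length (edge v w) + length (edge u w) ≤ 2
  edge-triangle (inj₁ _) (inj₁ _) (inj₁ _) = z≤n
  edge-triangle (inj₁ _) (inj₁ _) (inj₂ _) = ≤-refl
  edge-triangle (inj₁ _) (inj₂ _) (inj₁ _) = ≤-refl
  edge-triangle (inj₁ _) (inj₂ _) (inj₂ _) = ≤-refl
  edge-triangle (inj₂ _) (inj₁ _) (inj₁ _) = ≤-refl
  edge-triangle (inj₂ _) (inj₁ _) (inj₂ _) = ≤-refl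
  edge-triangle (inj₂ _) (inj₂ _) (inj₁ _) = ≤-refl
  edge-triangle (inj₂ _) (inj₂ _) (inj₂ _) = z≤n

  edge≤1 : ∀ u v → length (edge u v) ≤ 1
  edge≤1 (inj₁ _) (inj₁ _) = z≤n
  edge≤1 (inj₁ _) (inj₂ _) = ≤-refl
  edge≤1 (inj₂ _) (inj₁ _) = ≤-refl
  edge≤1 (inj₂ _) (inj₂ _) = z≤n

  -- Inserting `v` creates the first two links and destroys the third; deleting it does the reverse.
  -- Either way, twice the number created minus the change in the number present is the sum of all
  -- three.
  turnover : List (Fin m ⊎ Fin n) → Fin m ⊎ Fin n → List (Fin m ⊎ Fin n) → ℕ
  turnover P v Q = length (link P (v ∷ Q)) + length (link (v ∷ []) Q) + length (link P Q)

  turnover≤2 : ∀ P v Q → turnover P v Q ≤ 2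
  turnover≤2 []          v []      = z≤n
  turnover≤2 []          v (w ∷ Q) =
    ≤-trans (≤-reflexive (+-identityʳ _)) (≤-trans (edge≤1 v w) (n≤1+n 1))
  turnover≤2 (u ∷ [])    v []      =
    ≤-trans (≤-reflexive (trans (+-identityʳ _) (+-identityʳ _))) (≤-trans (edge≤1 u v) (n≤1+n 1))
  turnover≤2 (u ∷ [])    v (w ∷ Q) = edge-triangle u v w
  turnover≤2 (_ ∷ u ∷ P) v Q       = turnover≤2 (u ∷ P) v Q

  -- What is still saved at the two ends of the sweep, where fewer than two bars are alive.
  slack : List (Fin m ⊎ Fin n) → ℕ
  slack []          = 6
  slack (_ ∷ [])    = 4
  slack (_ ∷ _ ∷ _) = 3

  -- On insertion the slack never rises. On deletion it rises by 1 when one bar is left and by 2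
  -- when none is, and in these cases the turnover is at most 1 and 0 instead of 2.
  turnover-slack : ∀ P v Q →
    turnover P v Q + slack (P ++ v ∷ Q) ≤ 2 + slack (P ++ Q) ×
    turnover P v Q + slack (P ++ Q) ≤ 2 + slack (P ++ v ∷ Q)
  turnover-slack []       v []          = m≤m+n 4 4 , ≤-refl
  turnover-slack []       v (w ∷ [])    =
    ≤-trans (+-monoˡ-≤ 3 (turnover≤2 [] v (w ∷ []))) (n≤1+n 5) ,
    +-monoˡ-≤ 4 (≤-trans (≤-reflexive (+-identityʳ _)) (edge≤1 v w))
  turnover-slack []       v (w ∷ x ∷ Q) =
    let b = +-monoˡ-≤ 3 (turnover≤2 [] v (w ∷ x ∷ Q)) in b , b
  turnover-slack (u ∷ []) v []          =
    ≤-trans (+-monoˡ-≤ 3 (turnover≤2 (u ∷ []) v [])) (n≤1+n 5) ,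
    +-monoˡ-≤ 4 (≤-trans (≤-reflexive (trans (+-identityʳ _) (+-identityʳ _))) (edge≤1 u v))
  turnover-slack (u ∷ []) v (w ∷ Q)     =
    let b = +-monoˡ-≤ 3 (turnover≤2 (u ∷ []) v (w ∷ Q)) in b , b
  turnover-slack (u ∷ t ∷ P) v Q        =
    let b = +-monoˡ-≤ 3 (turnover≤2 (u ∷ t ∷ P) v Q) in b , b

  length-path-++ : ∀ P Q → length (path (P ++ Q)) ≡ length (path P) + (length (link P Q) + length (path Q))
  length-path-++ P Q = trans (cong length (path-++ P Q))
    (trans (length-++ (path P)) (cong (length (path P) +_) (length-++ (link P Q))))

  length-path-insert : ∀ P v Q → length (path (P ++ v ∷ Q)) ≡
    length (path P) + (length (link P (v ∷ Q)) + (length (link (v ∷ []) Q) + length (path Q)))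
  length-path-insert P v Q = trans (length-path-++ P (v ∷ Q))
    (cong (λ z → length (path P) + (length (link P (v ∷ Q)) + z)) (length-++ (link (v ∷ []) Q)))

  -- k events have led to the list L of bars on the sweep line; C lists the edges seen so far.
  data Swept (k : ℕ) (C : List (Fin m × Fin n)) (L : List (Fin m ⊎ Fin n)) : Set where
    trivial : C ≡ [] → length L ≤ 1 → length L ≤ k → Swept k C L
    proper  : 2 * length C + slack L ≤ 2 * k + length (path L) → path L ⊆ C → Swept k C L

  private
    -- `x` and `y` count the links made by an insertion, `z` the one broken, `p` and `q` the edges
    -- of the untouched parts, and `c` the edges recorded before. `delete-arith` uses the same
    -- letters with the roles of `x + y` and `z` exchanged.
    insert-arith : ∀ {c k x y z p q s s′ i j} → i ≡ p + (x + (y + q)) → j ≡ p + (z + q) →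
      x + y + z + s′ ≤ 2 + s → 2 * c + s ≤ 2 * k + j →
      2 * (x + (y + c)) + s′ ≤ 2 * suc k + i
    insert-arith {c} {k} {x} {y} {z} {p} {q} {s} {s′} refl refl h₁ h₂ =
      +-cancelʳ-≤ (s + z) _ _ (begin
        2 * (x + (y + c)) + s′ + (s + z)                ≡⟨ e₁ x y c s′ s z ⟩
        (x + y + z + s′) + (2 * c + s) + (x + y)        ≤⟨ +-monoˡ-≤ (x + y) (+-mono-≤ h₁ h₂) ⟩
        (2 + s) + (2 * k + (p + (z + q))) + (x + y)     ≡⟨ e₂ x y k p q s z ⟩
        2 * suc k + (p + (x + (y + q))) + (s + z)       ∎)
      where
      open ≤-Reasoning
      e₁ : ∀ x y c s′ s z → 2 * (x + (y + c)) + s′ + (s + z) ≡ (x + y + z + s′) + (2 * c + s) + (x + y)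
      e₁ = solve-∀
      e₂ : ∀ x y k p q s z → (2 + s) + (2 * k + (p + (z + q))) + (x + y) ≡ 2 * suc k + (p + (x + (y + q))) + (s + z)
      e₂ = solve-∀

    delete-arith : ∀ {c k x y z p q s s′ i j} → i ≡ p + (x + (y + q)) → j ≡ p + (z + q) →
      x + y + z + s ≤ 2 + s′ → 2 * c + s′ ≤ 2 * k + i →
      2 * (z + c) + s ≤ 2 * suc k + j
    delete-arith {c} {k} {x} {y} {z} {p} {q} {s} {s′} refl refl h₁ h₂ =
      +-cancelʳ-≤ (s′ + (x + y)) _ _ (begin
        2 * (z + c) + s + (s′ + (x + y))                 ≡⟨ e₁ x y c s′ s z ⟩
        (x + y + z + s) + (2 * c + s′) + z               ≤⟨ +-monoˡ-≤ z (+-mono-≤ h₁ h₂) ⟩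
        (2 + s′) + (2 * k + (p + (x + (y + q)))) + z     ≡⟨ e₂ x y k p q s′ z ⟩
        2 * suc k + (p + (z + q)) + (s′ + (x + y))       ∎)
      where
      open ≤-Reasoning
      e₁ : ∀ x y c s′ s z → 2 * (z + c) + s + (s′ + (x + y)) ≡ (x + y + z + s) + (2 * c + s′) + z
      e₁ = solve-∀
      e₂ : ∀ x y k p q s′ z → (2 + s′) + (2 * k + (p + (x + (y + q)))) + z ≡ 2 * suc k + (p + (z + q)) + (s′ + (x + y))
      e₂ = solve-∀

    first-edge : ∀ {l k} → l ≤ 1 → 1 ≤ k → 2 * l + 3 ≤ 2 * suc k + l
    first-edge {zero}  {suc k} _ _ = ≤-trans (m≤n+m 3 (suc (2 * k))) (≤-reflexive (e k))
      where
      e : ∀ k → suc (2 * k) + 3 ≡ 2 * suc (suc k) + 0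
      e = solve-∀
    first-edge {suc zero} {suc k} _ _ = ≤-trans (m≤n+m 5 (2 * k)) (≤-reflexive (e k))
      where
      e : ∀ k → 2 * k + 5 ≡ 2 * suc (suc k) + 1
      e = solve-∀
    first-edge {suc (suc _)} (s≤s ()) _

  Extends : ℕ → List (Fin m × Fin n) → List (Fin m ⊎ Fin n) → Set
  Extends k C L = ∃[ C′ ] (C ⊆ C′ × Swept k C′ L)

  -- The inequality of `proper` is false at the start, where it would read 6 ≤ 0. It begins to hold
  -- when two bars are alive for the first time, which `first-edge` checks; up to that moment the
  -- state is `trivial`, whose bound `length L ≤ k` supplies the event that has brought in the first
  -- bar.
  sweep-insert : ∀ {k C} P v Q → Swept k C (P ++ Q) → Extends (suc k) C (P ++ v ∷ Q)
  sweep-insert []       v []       (trivial refl _ _) = [] , (λ c → c) , trivial refl ≤-refl (s≤s z≤n)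
  sweep-insert []       v (w ∷ []) (trivial refl _ h) = edge v w ++ [] , (λ ()) ,
    proper (subst (λ l → 2 * l + 3 ≤ 2 * suc _ + l) (sym (trans (length-++ (edge v w)) (+-identityʳ _)))
             (first-edge (edge≤1 v w) h)) (λ e → e)
  sweep-insert (u ∷ []) v []       (trivial refl _ h) = edge u v ++ [] , (λ ()) ,
    proper (subst (λ l → 2 * l + 3 ≤ 2 * suc _ + l) (sym (trans (length-++ (edge u v)) (+-identityʳ _)))
             (first-edge (edge≤1 u v) h)) (λ e → e)
  sweep-insert []           v (_ ∷ _ ∷ _) (trivial _ (s≤s ()) _)
  sweep-insert (u ∷ [])     v (_ ∷ _)     (trivial _ (s≤s ()) _)
  sweep-insert (_ ∷ _ ∷ _)  v Q           (trivial _ (s≤s ()) _)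
  sweep-insert {k} {C} P v Q (proper h sub) =
    X ++ Y ++ C , (λ e → ∈-++⁺ʳ X (∈-++⁺ʳ Y e)) ,
    proper (subst (λ l → 2 * l + slack (P ++ v ∷ Q) ≤ 2 * suc k + length (path (P ++ v ∷ Q))) (sym len)
             (insert-arith {length C} {k} {length X} {length Y} {length (link P Q)} {length (path P)}
               (length-path-insert P v Q) (length-path-++ P Q) (proj₁ (turnover-slack P v Q)) h))
           sub′
    where
    X = link P (v ∷ Q)
    Y = link (v ∷ []) Q
    len : length (X ++ Y ++ C) ≡ length X + (length Y + length C)
    len = trans (length-++ X) (cong (length X +_) (length-++ Y))
    sub″ : path P ++ link P Q ++ path Q ⊆ C
    sub″ e = sub (subst (_ ∈_) (sym (path-++ P Q)) e)
    sub′ : path (P ++ v ∷ Q) ⊆ X ++ Y ++ C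
    sub′ e with ∈-++⁻ (path P) (subst (_ ∈_) (path-++ P (v ∷ Q)) e)
    ... | inj₁ i = ∈-++⁺ʳ X (∈-++⁺ʳ Y (sub″ (∈-++⁺ˡ i)))
    ... | inj₂ i with ∈-++⁻ X i
    ...   | inj₁ j = ∈-++⁺ˡ j
    ...   | inj₂ j with ∈-++⁻ Y j
    ...     | inj₁ l = ∈-++⁺ʳ X (∈-++⁺ˡ l)
    ...     | inj₂ l = ∈-++⁺ʳ X (∈-++⁺ʳ Y (sub″ (∈-++⁺ʳ (path P) (∈-++⁺ʳ (link P Q) l))))

  sweep-delete : ∀ {k C} P v Q → Swept k C (P ++ v ∷ Q) → Extends (suc k) C (P ++ Q)
  sweep-delete []          v []      (trivial refl _ _) = [] , (λ c → c) , trivial refl z≤n z≤n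
  sweep-delete []          v (_ ∷ _) (trivial _ (s≤s ()) _)
  sweep-delete (_ ∷ [])    v Q       (trivial _ (s≤s ()) _)
  sweep-delete (_ ∷ _ ∷ _) v Q       (trivial _ (s≤s ()) _)
  sweep-delete {k} {C} P v Q (proper h sub) =
    Z ++ C , ∈-++⁺ʳ Z ,
    proper (subst (λ l → 2 * l + slack (P ++ Q) ≤ 2 * suc k + length (path (P ++ Q))) (sym (length-++ Z))
             (delete-arith {length C} {k} {length (link P (v ∷ Q))} {length (link (v ∷ []) Q)} {length Z} {length (path P)}
               (length-path-insert P v Q) (length-path-++ P Q) (proj₂ (turnover-slack P v Q)) h))
           sub′
    where
    Z = link P Q
    sub″ : path P ++ link P (v ∷ Q) ++ path (v ∷ Q) ⊆ C
    sub″ e = sub (subst (_ ∈_) (sym (path-++ P (v ∷ Q))) e)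
    sub′ : path (P ++ Q) ⊆ Z ++ C
    sub′ e with ∈-++⁻ (path P) (subst (_ ∈_) (path-++ P Q) e)
    ... | inj₁ i = ∈-++⁺ʳ Z (sub″ (∈-++⁺ˡ i))
    ... | inj₂ i with ∈-++⁻ Z i
    ...   | inj₁ j = ∈-++⁺ˡ j
    ...   | inj₂ j = ∈-++⁺ʳ Z (sub″ (∈-++⁺ʳ (path P) (∈-++⁺ʳ (link P (v ∷ Q)) (∈-++⁺ʳ (link (v ∷ []) Q) j))))

-- Moving all bars through their stages

module _ {m n : ℕ} where

  Swept-mono : ∀ {k l C} {L : List (Fin m ⊎ Fin n)} → k ≤ l → Swept k C L → Swept l C L
  Swept-mono k≤l (trivial c l₁ l₂) = trivial c l₁ (≤-trans l₂ k≤l)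
  Swept-mono {L = L} k≤l (proper h s) =
    proper (≤-trans h (+-monoˡ-≤ (length (path L)) (*-monoʳ-≤ 2 k≤l))) s

  path⊆ : ∀ {k C} {L : List (Fin m ⊎ Fin n)} → Swept k C L → path L ⊆ C
  path⊆ {L = []}    (trivial _ _ _) ()
  path⊆ {L = _ ∷ []} (trivial _ _ _) ()
  path⊆ {L = _ ∷ _ ∷ _} (trivial _ (s≤s ()) _)
  path⊆ (proper _ s) = s

  module _ {I : Set} (lab : I → Fin m ⊎ Fin n) where

    -- Stages: 0 before a bar begins, 1 while it is alive, 2 after it has ended.
    shown : ℕ → Fin m ⊎ Fin n → List (Fin m ⊎ Fin n)
    shown 1 v = v ∷ []
    shown _ v = []

    live : (I → ℕ) → List I → List (Fin m ⊎ Fin n)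
    live σ []       = []
    live σ (a ∷ as) = shown (σ a) (lab a) ++ live σ as

    -- A bar in stage i has passed i of its two ends, so the sum of the stages is the number of
    -- events so far.
    total : (I → ℕ) → List I → ℕ
    total σ []       = 0
    total σ (a ∷ as) = σ a + total σ as

    sweep-one : ∀ {i i′ k C} P v Q → i ≤ i′ → i′ ≤ 2 →
      Swept (i + k) C (P ++ shown i v ++ Q) → Extends (i′ + k) C (P ++ shown i′ v ++ Q)
    sweep-one {zero}     {zero}     P v Q _ _ h = _ , (λ c → c) , h
    sweep-one {zero}     {suc zero} P v Q _ _ h = sweep-insert P v Q h
    -- The bar has begun and ended between two observed moments. It is never put on the line, and
    -- its two events only enlarge the bound.
    sweep-one {zero}     {suc (suc zero)} P v Q _ _ h = _ , (λ c → c) , Swept-mono (m≤n+m _ 2) h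
    sweep-one {suc zero} {suc zero} P v Q _ _ h = _ , (λ c → c) , h
    sweep-one {suc zero} {suc (suc zero)} P v Q _ _ h = sweep-delete P v Q h
    sweep-one {suc (suc zero)} {suc (suc zero)} P v Q _ _ h = _ , (λ c → c) , h
    sweep-one {_} {suc (suc (suc _))} P v Q _ (s≤s (s≤s ())) h
    sweep-one {suc _} {zero} P v Q () _ h
    sweep-one {suc (suc _)} {suc zero} P v Q (s≤s ()) _ h
    sweep-one {suc (suc (suc _))} {suc (suc zero)} P v Q (s≤s (s≤s ())) _ h

    infix 4 _⊑_
    _⊑_ : (I → ℕ) → (I → ℕ) → Set
    σ ⊑ σ′ = ∀ a → σ a ≤ σ′ a

    -- The bars change stage one by one, `P` being the part already updated. The mixed lists in
    -- between need not occur on any vertical line, which does no harm, since the invariant survives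
    -- every insertion and deletion.
    sweep-list : ∀ {σ σ′ C} k P as → σ ⊑ σ′ → σ′ ⊑ (λ _ → 2) →
      Swept (total σ as + k) C (P ++ live σ as) → Extends (total σ′ as + k) C (P ++ live σ′ as)
    sweep-list k P [] _ _ h = _ , (λ c → c) , h
    sweep-list {σ} {σ′} {C} k P (a ∷ as) le bd h
      with sweep-one P (lab a) (live σ as) (le a) (bd a)
             (subst (λ z → Swept z C (P ++ shown (σ a) (lab a) ++ live σ as)) (+-assoc (σ a) (total σ as) k) h)
    ... | C₁ , C⊆C₁ , h₁
      with sweep-list (σ′ a + k) (P ++ shown (σ′ a) (lab a)) as le bd
             (subst₂ (λ z L → Swept z C₁ L) (e (σ′ a) (total σ as) k) (sym (++-assoc P _ _)) h₁)
      where
      e : ∀ x y z → x + (y + z) ≡ y + (x + z)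
      e = solve-∀
    ... | C₂ , C₁⊆C₂ , h₂ = C₂ , (λ c → C₁⊆C₂ (C⊆C₁ c)) ,
      subst₂ (λ z L → Swept z C₂ L) (e (total σ′ as) (σ′ a) k) (++-assoc P _ _) h₂
      where
      e : ∀ x y z → x + (y + z) ≡ y + x + z
      e = solve-∀

    sweep-all : ∀ {σ C} as (σs : List (I → ℕ)) → Linked _⊑_ (σ ∷ σs) → All (_⊑ (λ _ → 2)) (σ ∷ σs) →
      Swept (total σ as + 0) C (live σ as) →
      ∃[ C′ ] (C ⊆ C′ × (∀ τ → τ ∈ σ ∷ σs → path (live τ as) ⊆ C′) ×
               Swept (total (λ _ → 2) as + 0) C′ (live (λ _ → 2) as))
    sweep-all {σ} {C} as [] _ (b ∷ []) h with sweep-list 0 [] as b (λ _ → ≤-refl) h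
    ... | C₁ , C⊆C₁ , h₁ = C₁ , C⊆C₁ , (λ { τ (here refl) e → C⊆C₁ (path⊆ h e) }) , h₁
    sweep-all {σ} {C} as (σ′ ∷ σs) (l ∷ ls) (b ∷ b′ ∷ bs) h with sweep-list 0 [] as l b′ h
    ... | C₁ , C⊆C₁ , h₁ with sweep-all as σs ls (b′ ∷ bs) h₁
    ...   | C₂ , C₁⊆C₂ , all , h₂ = C₂ , (λ e → C₁⊆C₂ (C⊆C₁ e)) ,
      (λ { τ (here refl) e → C₁⊆C₂ (C⊆C₁ (path⊆ h e)) ; τ (there i) e → all τ i e }) , h₂

    live-none : ∀ {i} → shown i ≡ (λ _ → []) → ∀ as → live (λ _ → i) as ≡ []
    live-none eq []       = refl
    live-none {i} eq (a ∷ as) = trans (cong (λ f → f (lab a) ++ live (λ _ → i) as) eq) (live-none eq as)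

    total-const : ∀ i as → total (λ _ → i) as ≡ length as * i
    total-const i []       = refl
    total-const i (a ∷ as) = cong (i +_) (total-const i as)

    -- At the end all bars are in stage 2 and the line is empty, so the slack is 6 and 2|C| + 6 ≤ 2
    -- · 2N. The alternative `C ≡ []` is a sweep that has stayed `trivial`.
    sweep-bound : ∀ as (σs : List (I → ℕ)) → Linked _⊑_ ((λ _ → 0) ∷ σs) → All (_⊑ (λ _ → 2)) σs →
      ∃[ C ] ((∀ τ → τ ∈ σs → path (live τ as) ⊆ C) × (C ≡ [] ⊎ length C + 3 ≤ 2 * length as))
    sweep-bound as σs ls bs
      with sweep-all as σs ls ((λ _ → z≤n) ∷ bs)
             (trivial {C = []} refl (≤-trans (≤-reflexive (cong length (live-none refl as))) z≤n)
                                    (≤-trans (≤-reflexive (cong length (live-none refl as))) z≤n))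
    ... | C , _ , seen , trivial eq _ _ = C , (λ τ i → seen τ (there i)) , inj₁ eq
    ... | C , _ , seen , proper h _ = C , (λ τ i → seen τ (there i)) , inj₂ (*-cancelˡ-≤ 2 (begin
        2 * (length C + 3)                               ≡⟨ *-distribˡ-+ 2 (length C) 3 ⟩
        2 * length C + 6                                 ≡⟨ cong (λ L → 2 * length C + slack L) (live-none refl as) ⟨
        2 * length C + slack (live (λ _ → 2) as)         ≤⟨ h ⟩
        2 * (total (λ _ → 2) as + 0) + length (path (live (λ _ → 2) as))
          ≡⟨ cong₂ (λ x L → 2 * (x + 0) + length (path L)) (total-const 2 as) (live-none refl as) ⟩
        2 * (length as * 2 + 0) + 0                      ≡⟨ e (length as) ⟩
        2 * (2 * length as)                              ∎))
      where
      open ≤-Reasoning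
      e : ∀ x → 2 * (x * 2 + 0) + 0 ≡ 2 * (2 * x)
      e = solve-∀

-- The lower bound for representations

_≟V_ : ∀ {m n} (v w : Fin m ⊎ Fin n) → Dec (v ≡ w)
_≟V_ = Sumₚ.≡-dec Finₚ._≟_ Finₚ._≟_

length-map-allFin : ∀ {A : Set} {k} (f : Fin k → A) → length (map f (allFin k)) ≡ k
length-map-allFin {k = k} f = trans (length-map f (allFin k)) (length-tabulate {n = k} (λ i → i))

module _ {m n t : ℕ} (R : BarRep (K m n) t) where
  open BarRep R

  vertices : List (Fin m ⊎ Fin n)
  vertices = map inj₁ (allFin m) ++ map inj₂ (allFin n)

  ∈-vertices : ∀ v → v ∈ vertices
  ∈-vertices (inj₁ x) = ∈-++⁺ˡ (∈-map⁺ inj₁ (∈-allFin x))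
  ∈-vertices (inj₂ y) = ∈-++⁺ʳ (map inj₁ (allFin m)) (∈-map⁺ inj₂ (∈-allFin y))

  indices : List (Fin m ⊎ Fin n) → List Idx
  indices = concatMap (λ v → map (v ,_) (allFin (length (bars v))))

  length-indices : ∀ vs → length (indices vs) ≤ t * length vs
  length-indices []       = z≤n
  length-indices (v ∷ vs) = begin
    length (map {B = Idx} (v ,_) (allFin (length (bars v))) ++ indices vs)
      ≡⟨ length-++ (map {B = Idx} (v ,_) (allFin (length (bars v)))) ⟩
    length (map {B = Idx} (v ,_) (allFin (length (bars v)))) + length (indices vs)
      ≡⟨ cong (_+ length (indices vs)) (length-map-allFin {Idx} (v ,_)) ⟩
    length (bars v) + length (indices vs)
      ≤⟨ +-mono-≤ (atMostT v) (length-indices vs) ⟩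
    t + t * length vs
      ≡⟨ *-suc t (length vs) ⟨
    t * length (v ∷ vs) ∎
    where open ≤-Reasoning

  byHeight : DecTotalOrder _ _ _
  byHeight = On.decTotalOrder ℚₚ.≤-decTotalOrder (λ a → y (barOf a))

  stacked : List Idx
  stacked = Sort.sort byHeight (indices vertices)

  stacked-sorted : AllPairs (λ a b → y (barOf a) ℚ.≤ y (barOf b)) stacked
  stacked-sorted = Sorted⇒AllPairs (DecTotalOrder.totalOrder byHeight) (Sort.sort-↗ byHeight _)

  ∈-stacked : ∀ a → a ∈ stacked
  ∈-stacked (v , i) = ∈-resp-↭ (↭-sym (Sort.sort-↭ byHeight _))
    (∈-concatMap⁺ _ (Any.map (λ { refl → ∈-map⁺ (v ,_) (∈-allFin i) }) (∈-vertices v)))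

  length-stacked : length stacked ≤ t * (m + n)
  length-stacked = begin
    length stacked               ≡⟨ ↭-length (Sort.sort-↭ byHeight _) ⟩
    length (indices vertices)    ≤⟨ length-indices vertices ⟩
    t * length vertices          ≡⟨ cong (t *_) (trans (length-++ (map inj₁ (allFin m)))
                                      (cong₂ _+_ (length-map-allFin {k = m} inj₁) (length-map-allFin {k = n} inj₂))) ⟩
    t * (m + n)                  ∎
    where open ≤-Reasoning

  -- Alive means `l ≤ x < r`. With this half-open convention both bars of a channel are alive at the
  -- left side of the channel.
  stage : ℚ → Idx → ℕ
  stage x a with x ℚₚ.<? l (barOf a)
  ... | yes _ = 0
  ... | no  _ with x ℚₚ.<? r (barOf a)
  ...   | yes _ = 1
  ...   | no  _ = 2

  stage≤2 : ∀ x a → stage x a ≤ 2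
  stage≤2 x a with x ℚₚ.<? l (barOf a)
  ... | yes _ = z≤n
  ... | no  _ with x ℚₚ.<? r (barOf a)
  ...   | yes _ = s≤s z≤n
  ...   | no  _ = ≤-refl

  stage-mono : ∀ {x x′} → x ℚ.≤ x′ → ∀ a → stage x a ≤ stage x′ a
  stage-mono {x} {x′} x≤x′ a with x ℚₚ.<? l (barOf a) | x′ ℚₚ.<? l (barOf a)
  ... | yes _ | _     = z≤n
  ... | no ¬p | yes q = ⊥-elim (¬p (ℚₚ.≤-<-trans x≤x′ q))
  ... | no _  | no _  with x ℚₚ.<? r (barOf a) | x′ ℚₚ.<? r (barOf a)
  ...   | yes _ | yes _ = ≤-refl
  ...   | yes _ | no _  = n≤1+n 1
  ...   | no ¬p | yes q = ⊥-elim (¬p (ℚₚ.≤-<-trans x≤x′ q))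
  ...   | no _  | no _  = ≤-refl

  alive⇒stage : ∀ x a → l (barOf a) ℚ.≤ x → x ℚ.< r (barOf a) → stage x a ≡ 1
  alive⇒stage x a l≤x x<r with x ℚₚ.<? l (barOf a)
  ... | yes p = ⊥-elim (ℚₚ.<-irrefl refl (ℚₚ.<-≤-trans p l≤x))
  ... | no  _ with x ℚₚ.<? r (barOf a)
  ...   | yes _ = refl
  ...   | no ¬p = ⊥-elim (¬p x<r)

  stage⇒alive : ∀ x a → stage x a ≡ 1 → l (barOf a) ℚ.≤ x × x ℚ.< r (barOf a)
  stage⇒alive x a eq with x ℚₚ.<? l (barOf a)
  stage⇒alive x a () | yes p
  ... | no ¬p with x ℚₚ.<? r (barOf a)
  ...   | yes q = ℚₚ.≮⇒≥ ¬p , q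
  stage⇒alive x a () | no _ | no _

  -- The same x belongs to both bars, so they cannot be disjoint unless their heights differ.
  same-height : ∀ x a c → stage x a ≡ 1 → stage x c ≡ 1 → y (barOf c) ≡ y (barOf a) → proj₁ c ≡ proj₁ a
  same-height x a c sa sc eq with proj₁ c ≟V proj₁ a
  ... | yes p = p
  ... | no ¬p with disjoint c a (λ c≡a → ¬p (cong proj₁ c≡a)) | stage⇒alive x a sa | stage⇒alive x c sc
  ...   | inj₁ y≢        | _ | _ = ⊥-elim (y≢ eq)
  ...   | inj₂ (inj₁ rc<la) | la≤x , _ | _ , x<rc = ⊥-elim (ℚₚ.<-irrefl refl (ℚₚ.<-≤-trans (ℚₚ.<-trans x<rc rc<la) la≤x))
  ...   | inj₂ (inj₂ ra<lc) | _ , x<ra | lc≤x , _ = ⊥-elim (ℚₚ.<-irrefl refl (ℚₚ.<-≤-trans (ℚₚ.<-trans x<ra ra<lc) lc≤x))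

  alive : ℚ → List Idx → List (Fin m ⊎ Fin n)
  alive x = live proj₁ (stage x)

  private
    module _ {x : ℚ} (a b : Idx) (sa : stage x a ≡ 1) (sb : stage x b ≡ 1) (a<b : y (barOf a) ℚ.< y (barOf b))
             (free : ∀ c → stage x c ≡ 1 → ¬ (y (barOf a) ℚ.< y (barOf c) × y (barOf c) ℚ.< y (barOf b))) where

      -- Scan upwards from `a`. A live bar met before `b` cannot lie strictly between, so it has the
      -- height of `a` or of `b`, and then also the vertex. In the first case the scan goes on from
      -- it, in the second the edge is found.
      above : ∀ as → All (λ c → y (barOf a) ℚ.≤ y (barOf c)) as →
        AllPairs (λ a b → y (barOf a) ℚ.≤ y (barOf b)) as → b ∈ as →
        edge (proj₁ a) (proj₁ b) ⊆ link (proj₁ a ∷ []) (alive x as) ++ path (alive x as)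
      above (c ∷ as) (a≤c ∷ a≤as) (c≤as ∷ so) b∈ with stage x c in sc
      above (c ∷ as) (a≤c ∷ a≤as) (c≤as ∷ so) (here refl) | zero = ⊥-elim (0≢1+n (trans (sym sc) sb))
      above (c ∷ as) (a≤c ∷ a≤as) (c≤as ∷ so) (there b∈)  | zero = above as a≤as so b∈
      above (c ∷ as) (a≤c ∷ a≤as) (c≤as ∷ so) (here refl) | suc (suc _) = ⊥-elim (0≢1+n (suc-injective (trans (sym sb) sc)))
      above (c ∷ as) (a≤c ∷ a≤as) (c≤as ∷ so) (there b∈)  | suc (suc _) = above as a≤as so b∈
      above (c ∷ as) (a≤c ∷ a≤as) (c≤as ∷ so) (here refl) | suc zero = ∈-++⁺ˡ
      above (c ∷ as) (a≤c ∷ a≤as) (c≤as ∷ so) (there b∈)  | suc zero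
        with ℚₚ.<-cmp (y (barOf a)) (y (barOf c)) | ℚₚ.<-cmp (y (barOf c)) (y (barOf b))
      ... | tri> _ _ c<a | _ = ⊥-elim (ℚₚ.<-irrefl refl (ℚₚ.<-≤-trans c<a a≤c))
      ... | tri< a<c _ _ | tri< c<b _ _ = ⊥-elim (free c sc (a<c , c<b))
      ... | tri< a<c _ _ | tri> _ _ b<c = ⊥-elim (ℚₚ.<-irrefl refl (ℚₚ.<-≤-trans b<c (All.lookup c≤as b∈)))
      ... | tri< a<c _ _ | tri≈ _ c≡b _ =
        subst (λ z → edge (proj₁ a) z ⊆ _) (same-height x b c sb sc c≡b) ∈-++⁺ˡ
      ... | tri≈ _ a≡c _ | _ = λ e → ∈-++⁺ʳ (edge (proj₁ a) (proj₁ c))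
        (subst (λ z → _ ∈ link (z ∷ []) (alive x as) ++ path (alive x as)) (sym (same-height x a c sa sc (sym a≡c)))
               (above as a≤as so b∈ e))

      consecutive-edge : ∀ as → AllPairs (λ a b → y (barOf a) ℚ.≤ y (barOf b)) as → a ∈ as → b ∈ as →
        edge (proj₁ a) (proj₁ b) ⊆ path (alive x as)
      consecutive-edge (c ∷ as) (c≤as ∷ so) (here refl) (here refl) = ⊥-elim (ℚₚ.<-irrefl refl a<b)
      consecutive-edge (c ∷ as) (c≤as ∷ so) (here refl) (there b∈) = subst (λ i → edge (proj₁ a) (proj₁ b) ⊆ path (shown {I = Idx} proj₁ i (proj₁ a) ++ alive x as))
        (sym sa) (above as c≤as so b∈)
      consecutive-edge (c ∷ as) (c≤as ∷ so) (there a∈) (here refl) = ⊥-elim (ℚₚ.<-irrefl refl (ℚₚ.<-≤-trans a<b (All.lookup c≤as a∈)))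
      consecutive-edge (c ∷ as) (c≤as ∷ so) (there a∈) (there b∈) with stage x c
      ... | zero        = consecutive-edge as so a∈ b∈
      ... | suc zero    = λ e → ∈-++⁺ʳ (link (proj₁ c ∷ []) (alive x as)) (consecutive-edge as so a∈ b∈ e)
      ... | suc (suc _) = consecutive-edge as so a∈ b∈

  -- The moment is the left side `x₁` of the channel: a bar alive there at a height strictly between
  -- would extend to the right of `x₁` and obstruct the channel.
  seen-at : ∀ {a b} → SeesUp a b → ∃[ x ] edge (proj₁ a) (proj₁ b) ⊆ path (alive x stacked)
  seen-at {a} {b} (a<b , x₁ , x₂ , x₁<x₂ , la≤x₁ , x₂≤ra , lb≤x₁ , x₂≤rb , free) = x₁ ,
    consecutive-edge {x₁} a b (alive⇒stage x₁ a la≤x₁ (ℚₚ.<-≤-trans x₁<x₂ x₂≤ra)) (alive⇒stage x₁ b lb≤x₁ (ℚₚ.<-≤-trans x₁<x₂ x₂≤rb)) a<b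
      (λ c sc (a<c , c<b) → free c (a<c , c<b , ℚₚ.≤-<-trans (proj₁ (stage⇒alive x₁ c sc)) x₁<x₂ , proj₂ (stage⇒alive x₁ c sc)))
      stacked stacked-sorted (∈-stacked a) (∈-stacked b)

  seen : (e : Fin m × Fin n) → ∃[ x ] e ∈ path (alive x stacked)
  seen (v , w) with adj⇒sees (inj₁ v) (inj₂ w) (λ ()) tt
  ... | i , j , inj₁ up with seen-at up
  ...   | x , sub = x , sub (here refl)
  seen (v , w) | i , j , inj₂ up with seen-at up
  ...   | x , sub = x , sub (here refl)

  -- One moment for each edge is enough; the sweep jumps from one to the next and the stages account
  -- for all that happens between.
  times : List ℚ
  times = Sort.sort ℚₚ.≤-decTotalOrder (map (λ k → proj₁ (seen (remQuot n k))) (allFin (m * n)))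

  ∈-times : ∀ e → proj₁ (seen e) ∈ times
  ∈-times (v , w) = ∈-resp-↭ (↭-sym (Sort.sort-↭ ℚₚ.≤-decTotalOrder _))
    (subst (λ e → proj₁ (seen e) ∈ map (λ k → proj₁ (seen (remQuot n k))) (allFin (m * n))) (Finₚ.remQuot-combine v w)
      (∈-map⁺ (λ k → proj₁ (seen (remQuot n k))) (∈-allFin (combine v w))))

  -- Sending an edge to a position at which it stands in `C` is injective, however often `C` repeats
  -- its entries.
  all-edges : ∀ (C : List (Fin m × Fin n)) → (∀ e → e ∈ C) → m * n ≤ length C
  all-edges C all = Finₚ.injective⇒≤ {f = λ k → Any.index (all (remQuot n k))} inj
    where
    inj : ∀ {i j} → Any.index (all (remQuot n i)) ≡ Any.index (all (remQuot n j)) → i ≡ j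
    inj {i} {j} eq = trans (sym (Finₚ.combine-remQuot {m} n i)) (trans (cong (λ e → combine (proj₁ e) (proj₂ e))
      (trans (lookup-index (all (remQuot n i))) (trans (cong (lookup C) eq) (sym (lookup-index (all (remQuot n j)))))))
      (Finₚ.combine-remQuot {m} n j))

  edges-bound : 1 ≤ m → 1 ≤ n → m * n + 3 ≤ 2 * (t * (m + n))
  edges-bound 1≤m 1≤n with sweep-bound proj₁ stacked (map stage times) rising bounded
    where
    chain : ∀ ts → Linked ℚ._≤_ ts → Linked (_⊑_ proj₁) ((λ _ → 0) ∷ map stage ts)
    chain []       _  = [-]
    chain (t ∷ ts) so = (λ _ → z≤n) ∷ Linkedₚ.map⁺ (Linked.map stage-mono so)
    rising : Linked (_⊑_ proj₁) ((λ _ → 0) ∷ map stage times)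
    rising = chain times (Sort.sort-↗ ℚₚ.≤-decTotalOrder _)
    bounded : All (λ σ → _⊑_ proj₁ σ (λ _ → 2)) (map stage times)
    bounded = All.tabulate λ i → lem times i
      where
      lem : ∀ ts {σ} → σ ∈ map stage ts → _⊑_ proj₁ σ (λ _ → 2)
      lem (t ∷ ts) (here refl) = stage≤2 t
      lem (t ∷ ts) (there i)   = lem ts i
  ... | C , sees , bound with m * n ≤? length C
  ...   | no  ¬p = ⊥-elim (¬p (all-edges C (λ e → sees _ (∈-map⁺ stage (∈-times e)) (proj₂ (seen e)))))
  ...   | yes mn≤C with bound
  ...     | inj₁ refl = ⊥-elim (1+n≰n (≤-trans (*-mono-≤ 1≤m 1≤n) mn≤C))
  ...     | inj₂ h = ≤-trans (+-monoˡ-≤ 3 mn≤C) (≤-trans h (*-monoʳ-≤ 2 length-stacked))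

-- Diagrams

split : ∀ j w → j < w ⊎ ∃[ i ] j ≡ w + i
split j w with j <? w
... | yes p = inj₁ p
... | no ¬p = inj₂ (j ∸ w , sym (m+[n∸m]≡n (≮⇒≥ ¬p)))

module _ {A : Set} where

  -- A bar occupying the columns start, …, start + extra; its height is its position in the list.
  record Item : Set where
    constructor item
    field
      label       : A
      start extra : ℕ
  open Item public

  On : ℕ → Item → Set
  On j b = start b ≤ j × j ≤ start b + extra b

  on? : ∀ j b → Dec (On j b)
  on? j b = (start b ≤? j) ×-dec (j ≤? start b + extra b)

  shift : ℕ → List Item → List Item
  shift k = map (λ b → item (label b) (k + start b) (extra b))

  opaque
    -- The labels met by a vertical line through column j, read upwards. As it is opaque, all later
    -- arguments rest on the four equations below.
    column : ℕ → List Item → List A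
    column j L = map label (filter (on? j) L)

    column-[] : ∀ j → column j [] ≡ []
    column-[] j = refl

    column-∷-on : ∀ {j b} L → On j b → column j (b ∷ L) ≡ label b ∷ column j L
    column-∷-on {j} L o = cong (map label) (filter-accept (on? j) o)

    column-∷-off : ∀ {j b} L → ¬ On j b → column j (b ∷ L) ≡ column j L
    column-∷-off {j} L o = cong (map label) (filter-reject (on? j) o)

    column-++ : ∀ j L M → column j (L ++ M) ≡ column j L ++ column j M
    column-++ j L M = trans (cong (map label) (filter-++ (on? j) L M)) (map-++ label (filter (on? j) L) _)

  single-on : ∀ {j b} → On j b → column j (b ∷ []) ≡ label b ∷ []
  single-on {j} {b} o = trans (column-∷-on [] o) (cong (label b ∷_) (column-[] j))

  single-off : ∀ {j b} → ¬ On j b → column j (b ∷ []) ≡ []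
  single-off {j} o = trans (column-∷-off [] o) (column-[] j)

  column-shift : ∀ k j L → column (k + j) (shift k L) ≡ column j L
  column-shift k j []      = trans (column-[] (k + j)) (sym (column-[] j))
  column-shift k j (b ∷ L) with column-shift k j L | on? j b
  ... | ih | yes o@(p , q) = trans (column-∷-on (shift k L)
          (+-monoʳ-≤ k p , ≤-trans (+-monoʳ-≤ k q) (≤-reflexive (sym (+-assoc k (start b) (extra b))))))
          (trans (cong (label b ∷_) ih) (sym (column-∷-on L o)))
  ... | ih | no ¬o = trans (column-∷-off (shift k L) λ (p , q) → ¬o
          (+-cancelˡ-≤ k _ _ p , +-cancelˡ-≤ k _ _ (≤-trans q (≤-reflexive (+-assoc k (start b) (extra b))))))
          (trans ih (sym (column-∷-off L ¬o)))

  column-shift-< : ∀ {k j} → j < k → ∀ L → column j (shift k L) ≡ []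
  column-shift-< j<k []      = column-[] _
  column-shift-< {k} j<k (b ∷ L) = trans
    (column-∷-off (shift k L) (λ (p , _) → <⇒≱ j<k (≤-trans (m≤m+n k (start b)) p))) (column-shift-< j<k L)

  column-reverse : ∀ j L → column j (reverse L) ≡ reverse (column j L)
  column-reverse j []      = trans (column-[] j) (cong reverse (sym (column-[] j)))
  column-reverse j (b ∷ L) = begin
    column j (reverse (b ∷ L))                   ≡⟨ cong (column j) (unfold-reverse b L) ⟩
    column j (reverse L ++ b ∷ [])               ≡⟨ column-++ j (reverse L) (b ∷ []) ⟩
    column j (reverse L) ++ column j (b ∷ [])    ≡⟨ cong₂ _++_ (column-reverse j L) single ⟩
    reverse (column j L) ++ reverse (column j (b ∷ []))
                                                 ≡⟨ reverse-++ (column j (b ∷ [])) (column j L) ⟨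
    reverse (column j (b ∷ []) ++ column j L)    ≡⟨ cong reverse (column-++ j (b ∷ []) L) ⟨
    reverse (column j (b ∷ L))                   ∎
    where
    open ≡-Reasoning
    single : column j (b ∷ []) ≡ reverse (column j (b ∷ []))
    single with on? j b
    ... | yes o = trans e (cong reverse (sym e))
      where e = single-on o
    ... | no  o = trans e (cong reverse (sym e))
      where e = single-off o

  record Diagram : Set where
    constructor diagram
    field
      width : ℕ
      items : List Item
  open Diagram public

  col : ℕ → Diagram → List A
  col j D = column j (items D)

  Narrow : Diagram → Set
  Narrow D = ∀ j → width D ≤ j → col j D ≡ []

  -- The bars of `E` come later in the list and are thus higher than those of `D`. When `D` is
  -- narrow no column meets both, so the heights do not interact.
  beside : Diagram → Diagram → Diagram
  beside D E = diagram (width D + width E) (items D ++ shift (width D) (items E))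

  flip : Diagram → Diagram
  flip D = diagram (width D) (reverse (items D))

  blank : Diagram
  blank = diagram 0 []

  flat : List A → Diagram
  flat []      = blank
  flat (v ∷ l) = beside (diagram 1 (item v 0 0 ∷ [])) (flat l)

  beside-left : ∀ {j} D E → j < width D → col j (beside D E) ≡ col j D
  beside-left {j} D E j< = trans (column-++ j (items D) _)
    (trans (cong (col j D ++_) (column-shift-< j< (items E))) (++-identityʳ _))

  beside-right : ∀ j D E → Narrow D → col (width D + j) (beside D E) ≡ col j E
  beside-right j D E D-narrow = trans (column-++ (width D + j) (items D) _)
    (cong₂ _++_ (D-narrow (width D + j) (m≤m+n _ j)) (column-shift (width D) j (items E)))

  col-flip : ∀ j D → col j (flip D) ≡ reverse (col j D)
  col-flip j D = column-reverse j (items D)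

  occupied : ∀ {D j} {v : A} {l} → Narrow D → col j D ≡ v ∷ l → j < width D
  occupied {D} {j} nar eq with j <? width D
  ... | yes p = p
  ... | no ¬p with trans (sym eq) (nar j (≮⇒≥ ¬p))
  ...   | ()

  beside-narrow : ∀ D E → Narrow D → Narrow E → Narrow (beside D E)
  beside-narrow D E nD nE j w≤j with split j (width D)
  ... | inj₁ j<w = ⊥-elim (<⇒≱ j<w (≤-trans (m≤m+n _ (width E)) w≤j))
  ... | inj₂ (i , refl) = trans (beside-right i D E nD) (nE i (+-cancelˡ-≤ (width D) _ _ w≤j))

  flip-narrow : ∀ D → Narrow D → Narrow (flip D)
  flip-narrow D nD j w≤j = trans (col-flip j D) (cong reverse (nD j w≤j))

  single-col : ∀ {v : A} {j} → j < 1 → column j (item v 0 0 ∷ []) ≡ v ∷ []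
  single-col {v} {zero} _ = single-on (z≤n , z≤n)
  single-col {v} {suc j} (s≤s ())

  single-narrow : ∀ v → Narrow (diagram 1 (item v 0 0 ∷ []))
  single-narrow v (suc j) w≤j = single-off λ ()

  flat-narrow : ∀ l → Narrow (flat l)
  flat-narrow []      j _ = column-[] j
  flat-narrow (v ∷ l) = beside-narrow (diagram 1 (item v 0 0 ∷ [])) (flat l) (single-narrow v) (flat-narrow l)

  module _ (colour : A → Bool) where

    -- Such a list has odd length and colour `c` at both ends, so it can be inserted between two
    -- bars of the other colour without breaking the alternation.
    data Alternating (c : Bool) : List A → Set where
      one  : ∀ {v} → colour v ≡ c → Alternating c (v ∷ [])
      cons : ∀ {v w l} → colour v ≡ c → colour w ≡ not c → Alternating c l → Alternating c (v ∷ w ∷ l)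

    join : ∀ {c l₁ l₂ l₃} → Alternating c l₁ → Alternating (not c) l₂ → Alternating c l₃ →
      Alternating c (l₁ ++ l₂ ++ l₃)
    join     (one p)      (one q)       c = cons p q c
    join {c} (one p)      (cons q r b)  d = cons p q (join (one (trans r (not-involutive c))) b d)
    join     (cons p q a) b             d = cons p q (join a b d)

    snoc : ∀ {c l v w} → Alternating c l → colour w ≡ not c → colour v ≡ c → Alternating c (l ++ w ∷ v ∷ [])
    snoc a q p = join a (one q) (one p)

    reverse-alternating : ∀ {c l} → Alternating c l → Alternating c (reverse l)
    reverse-alternating (one p) = one p
    reverse-alternating {c} (cons {v} {w} {l} p q a) = subst (Alternating c)
      (sym (trans (unfold-reverse v (w ∷ l)) (trans (cong (_++ v ∷ []) (unfold-reverse w l)) (++-assoc (reverse l) _ _))))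
      (snoc (reverse-alternating a) q p)

    record Zone (c : Bool) (D : Diagram) : Set where
      field
        narrow      : Narrow D
        alternating : ∀ j → j < width D → Alternating c (col j D)
    open Zone public

    blank-zone : ∀ {c} → Zone c blank
    blank-zone = record { narrow = λ j _ → column-[] j ; alternating = λ _ () }

    beside-zone : ∀ {c D E} → Zone c D → Zone c E → Zone c (beside D E)
    beside-zone {c} {D} {E} zD zE = record
      { narrow = beside-narrow D E (narrow zD) (narrow zE)
      ; alternating = alt }
      where
      alt : ∀ j → j < width D + width E → Alternating c (col j (beside D E))
      alt j j<w with split j (width D)
      ... | inj₁ p = subst (Alternating c) (sym (beside-left D E p)) (alternating zD j p)
      ... | inj₂ (i , refl) = subst (Alternating c) (sym (beside-right i D E (narrow zD)))
                                (alternating zE i (+-cancelˡ-< (width D) _ _ j<w))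

    flat-zone : ∀ {c l} → All (λ v → colour v ≡ c) l → Zone c (flat l)
    flat-zone []       = blank-zone
    flat-zone {l = v ∷ l} (p ∷ ps) = beside-zone
      (record { narrow = single-narrow v ; alternating = λ j j<1 → subst (Alternating _) (sym (single-col j<1)) (one p) })
      (flat-zone ps)

-- Nested blocks

module _ {A : Set} where

  Next : A → A → List A → Set
  Next u v l = ∃[ l₁ ] ∃[ l₂ ] l ≡ l₁ ++ u ∷ v ∷ l₂

  next-inside : ∀ {u v l} a b → Next u v l → Next u v (a ++ l ++ b)
  next-inside a b (l₁ , l₂ , refl) = a ++ l₁ , l₂ ++ b ,
    trans (cong (a ++_) (++-assoc l₁ _ b)) (sym (++-assoc a l₁ _))

  next-reverse : ∀ {u v l} → Next u v l → Next v u (reverse l)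
  next-reverse {u} {v} (l₁ , l₂ , refl) = reverse l₂ , reverse l₁ , (begin
    reverse (l₁ ++ u ∷ v ∷ l₂)                      ≡⟨ reverse-++ l₁ (u ∷ v ∷ l₂) ⟩
    reverse (u ∷ v ∷ l₂) ++ reverse l₁              ≡⟨ cong (_++ reverse l₁) (reverse-++ (u ∷ v ∷ []) l₂) ⟩
    (reverse l₂ ++ v ∷ u ∷ []) ++ reverse l₁        ≡⟨ ++-assoc (reverse l₂) _ _ ⟩
    reverse l₂ ++ v ∷ u ∷ reverse l₁                ∎)
    where open ≡-Reasoning

  Meets : Diagram {A} → A → A → Set
  Meets D u v = ∃[ j ] (Next u v (col j D) ⊎ Next v u (col j D))

  next-occupied : ∀ (D : Diagram {A}) {j u v} → Narrow D → Next u v (col j D) → j < width D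
  next-occupied D nD ([]    , l₂ , eq) = occupied {D = D} nD eq
  next-occupied D nD (x ∷ _ , l₂ , eq) = occupied {D = D} nD eq

  snoc-occupied : ∀ (D : Diagram {A}) {j v} l → Narrow D → col j D ≡ l ++ v ∷ [] → j < width D
  snoc-occupied D []      nD eq = occupied {D = D} nD eq
  snoc-occupied D (_ ∷ _) nD eq = occupied {D = D} nD eq

  -- D is to be drawn between the bar labelled ρ d below it and the bar labelled ρ (d + 1) above it.
  module _ (ρ : ℕ → A) where

    -- The two bounding bars do not belong to `D`. A bar that is lowest in some column of `D` will
    -- see the bar below `D` there, and one that is highest will see the bar above.
    data Reach (D : Diagram {A}) (d : ℕ) (f : A) : ℕ → Set where
      below : ∀ {j l} → col j D ≡ f ∷ l → Reach D d f d
      above : ∀ {j} l → col j D ≡ l ++ f ∷ [] → Reach D d f (suc d)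
      meet  : ∀ {h} → Meets D f (ρ h) → Reach D d f h

    reach-via : ∀ {D E d f g} → (∀ j → ∃[ i ] (col j D ≡ [] ⊎ col i E ≡ col j D)) → Reach D d f g → Reach E d f g
    reach-via e (below {j} p) with e j
    ... | i , inj₂ q = below (trans q p)
    ... | i , inj₁ q with trans (sym p) q
    ...   | ()
    reach-via e (above {j} l p) with e j
    ... | i , inj₁ q = ⊥-elim (case l (trans (sym p) q))
      where case : ∀ {x : A} l → ¬ l ++ x ∷ [] ≡ []
            case [] ()
            case (_ ∷ _) ()
    ... | i , inj₂ q = above l (trans q p)
    reach-via {D} {E} {f = f} e (meet {h} (j , n)) with e j
    ... | i , inj₁ q = ⊥-elim (Sum.[ case , case ] n)
      where case : ∀ {u v} → ¬ Next u v (col j D)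
            case ([] , _ , r) with trans (sym q) r
            ... | ()
            case (_ ∷ _ , _ , r) with trans (sym q) r
            ... | ()
    ... | i , inj₂ q = meet (i , subst (λ l → Next f (ρ h) l ⊎ Next (ρ h) f l) (sym q) n)

    reach-left : ∀ {D d f g} E → Narrow D → Reach D d f g → Reach (beside D E) d f g
    reach-left {D} E nD = reach-via e
      where
      e : ∀ j → ∃[ i ] (col j D ≡ [] ⊎ col i (beside D E) ≡ col j D)
      e j with j <? width D
      ... | yes p = j , inj₂ (beside-left D E p)
      ... | no ¬p = j , inj₁ (nD j (≮⇒≥ ¬p))

    reach-right : ∀ {E d f g} D → Narrow D → Reach E d f g → Reach (beside D E) d f g
    reach-right {E} D nD = reach-via λ j → width D + j , inj₂ (beside-right j D E nD)

    reach-flat : ∀ {f l d} → f ∈ l → Reach (flat l) d f d × Reach (flat l) d f (suc d)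
    reach-flat {l = f ∷ l} (here refl) =
      reach-left (flat l) (single-narrow f) (below {j = 0} (single-col (s≤s z≤n))) , reach-left (flat l) (single-narrow f) (above {j = 0} [] (single-col (s≤s z≤n)))
    reach-flat {l = v ∷ l} (there i) with reach-flat i
    ... | p , q = reach-right _ (single-narrow v) p , reach-right _ (single-narrow v) q

    -- Bars ρ h, …, ρ (h + n), consecutive ones overlapping (the earlier one below) in a zone filled by J;
    -- the first bar starts pre columns early.
    module _ (J : ℕ → Diagram {A}) where

      run : ℕ → ℕ → ℕ
      run h zero    = 0
      run h (suc n) = width (J h) + suc (run (suc h) n)

      -- A staircase. Each bar has `pre` columns above its predecessor, then one column of its own,
      -- then the columns of the zone shared with its successor. In its own column it is visible
      -- from below and from above the whole fan.
      fan-items : ℕ → ℕ → ℕ → List Item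
      fan-items pre h zero    = item (ρ h) 0 pre ∷ []
      fan-items pre h (suc n) = item (ρ h) 0 (pre + width (J h)) ∷
        shift (suc pre) (items (J h) ++ fan-items (width (J h)) (suc h) n)

      fan : ℕ → ℕ → ℕ → Diagram
      fan pre h n = diagram (pre + suc (run h n)) (fan-items pre h n)

      fan-head : ∀ {j pre} h n → j ≤ pre → col j (fan pre h n) ≡ ρ h ∷ []
      fan-head h zero    j≤pre = single-on (z≤n , j≤pre)
      fan-head h (suc n) j≤pre = trans (column-∷-on _ (z≤n , ≤-trans j≤pre (m≤m+n _ _)))
        (cong (ρ h ∷_) (column-shift-< (s≤s j≤pre) (items (J h) ++ fan-items (width (J h)) (suc h) n)))

      fan-zone-column : ∀ {i} pre h n → i < width (J h) →
        col (suc pre + i) (fan pre h (suc n)) ≡ ρ h ∷ col i (J h) ++ ρ (suc h) ∷ []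
      fan-zone-column {i} pre h n i<w = trans
        (column-∷-on _ (z≤n , ≤-trans (≤-reflexive (sym (+-suc pre i))) (+-monoʳ-≤ pre i<w)))
        (cong (ρ h ∷_) (trans (column-shift (suc pre) i (items (J h) ++ fan-items (width (J h)) (suc h) n))
          (trans (column-++ i (items (J h)) _) (cong (col i (J h) ++_) (fan-head (suc h) n (<⇒≤ i<w))))))

      fan-later-column : ∀ {i} pre h n → Narrow (J h) → width (J h) ≤ i →
        col (suc pre + i) (fan pre h (suc n)) ≡ col i (fan (width (J h)) (suc h) n)
      fan-later-column {i} pre h n nJ w≤i = trans
        (column-∷-off _ (λ (_ , q) → <⇒≱ (s≤s w≤i) (+-cancelˡ-≤ pre _ _ (≤-trans (≤-reflexive (+-suc pre i)) q))))
        (trans (column-shift (suc pre) i (items (J h) ++ fan-items (width (J h)) (suc h) n))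
          (trans (column-++ i (items (J h)) _) (cong (_++ col i (fan (width (J h)) (suc h) n)) (nJ i w≤i))))

      module _ (narrowJ : ∀ p → Narrow (J p)) where

        fan-narrow : ∀ pre h n → Narrow (fan pre h n)
        fan-narrow pre h zero j w≤j =
          single-off (λ (_ , q) → 1+n≰n (≤-trans (≤-trans (≤-reflexive (+-comm 1 pre)) w≤j) q))
        fan-narrow pre h (suc n) j w≤j with split j (suc pre)
        ... | inj₁ j<s = ⊥-elim (<⇒≱ j<s (≤-trans (≤-trans (s≤s (m≤m+n pre _)) (≤-reflexive (sym (+-suc pre _)))) w≤j))
        ... | inj₂ (i , refl) = trans (fan-later-column pre h n (narrowJ h) (≤-trans (m≤m+n _ _) w≤i))
                                      (fan-narrow (width (J h)) (suc h) n i w≤i)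
          where
          w≤i : width (J h) + suc (run (suc h) n) ≤ i
          w≤i = +-cancelˡ-≤ (suc pre) _ _ (≤-trans (≤-reflexive (sym (+-suc pre _))) w≤j)

        fan-solo : ∀ pre h n k → k ≤ n → ∃[ i ] col (pre + i) (fan pre h n) ≡ ρ (h + k) ∷ []
        fan-solo pre h n zero _ = 0 , trans (fan-head h n (≤-reflexive (+-identityʳ pre)))
          (cong (λ z → ρ z ∷ []) (sym (+-identityʳ h)))
        fan-solo pre h (suc n) (suc k) (s≤s k≤n) with fan-solo (width (J h)) (suc h) n k k≤n
        ... | i , eq = suc (width (J h) + i) , (begin
          col (pre + suc (width (J h) + i)) (fan pre h (suc n))
            ≡⟨ cong (λ z → col z (fan pre h (suc n))) (+-suc pre _) ⟩
          col (suc pre + (width (J h) + i)) (fan pre h (suc n))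
            ≡⟨ fan-later-column pre h n (narrowJ h) (m≤m+n _ i) ⟩
          col (width (J h) + i) (fan (width (J h)) (suc h) n)
            ≡⟨ eq ⟩
          ρ (suc h + k) ∷ []
            ≡⟨ cong (λ z → ρ z ∷ []) (+-suc h k) ⟨
          ρ (h + suc k) ∷ [] ∎)
          where open ≡-Reasoning

        -- Both bars bounding zone `p` are present in the fan, so each of the three forms of `Reach`
        -- turns into neighbours in a column.
        fan-reach : ∀ {f g} pre h n p → h ≤ p → p < h + n → Reach (J p) p f g → Meets (fan pre h n) f (ρ g)
        fan-reach pre h zero p h≤p p< r = ⊥-elim (<⇒≱ p< (≤-trans (≤-reflexive (+-identityʳ h)) h≤p))
        fan-reach {f} {g} pre h (suc n) p h≤p p< r with m≤n⇒m<n∨m≡n h≤p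
        ... | inj₁ h<p with fan-reach (width (J h)) (suc h) n p h<p (≤-trans p< (≤-reflexive (+-suc h n))) r
        ...   | i , next with i <? width (J h)
        ...     | no ¬p = suc pre + i , subst (λ l → Next f (ρ g) l ⊎ Next (ρ g) f l)
                            (sym (fan-later-column pre h n (narrowJ h) (≮⇒≥ ¬p))) next
        -- In the larger fan this column also contains `ρ h` and part of `J h`, so the smaller fan
        -- is no guide to it. But there the smaller fan shows a single bar and has no neighbours to
        -- offer.
        ...     | yes p = ⊥-elim (Sum.[ short , short ] next)
          where
          short : ∀ {u v} → ¬ Next u v (col i (fan (width (J h)) (suc h) n))
          short (l₁ , l₂ , eq) = too-long l₁ (trans (sym (fan-head (suc h) n (<⇒≤ p))) eq)
            where
            too-long : ∀ {u v w : A} l₁ {l₂} → ¬ u ∷ [] ≡ l₁ ++ v ∷ w ∷ l₂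
            too-long []          ()
            too-long (_ ∷ [])    ()
            too-long (_ ∷ _ ∷ _) ()
        fan-reach pre h (suc n) h _ _ (below {i} eq) | inj₂ refl = suc pre + i , inj₂ ([] , _ ,
          trans (fan-zone-column pre h n (occupied {D = J h} (narrowJ h) eq)) (cong (λ z → ρ h ∷ z ++ ρ (suc h) ∷ []) eq))
        fan-reach pre h (suc n) h _ _ (above {i} l eq) | inj₂ refl = suc pre + i , inj₁ (ρ h ∷ l , [] ,
          trans (fan-zone-column pre h n (snoc-occupied (J h) l (narrowJ h) eq))
                (cong (ρ h ∷_) (trans (cong (_++ ρ (suc h) ∷ []) eq) (++-assoc l _ _))))
        fan-reach {f} {g} pre h (suc n) h _ _ (meet (i , next)) | inj₂ refl = suc pre + i , Sum.map lift lift next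
          where
          lift : ∀ {u v} → Next u v (col i (J h)) → Next u v (col (suc pre + i) (fan pre h (suc n)))
          lift nx = subst (Next _ _) (sym (fan-zone-column pre h n (next-occupied (J h) (narrowJ h) nx)))
                      (next-inside (ρ h ∷ []) (ρ (suc h) ∷ []) nx)

      -- A pair of bars η, η′ between ρ d and ρ (d + 1), touching these and ρ (d + 2), …, ρ (d + 2 + n).
      -- The zone between ρ (d + 1) and ρ (d + 2) is upside down, because ρ (d + 2) is the lower of the two.
      module _ (η η′ : A) (d n : ℕ) where

        private
          w W : ℕ
          w = width (J (suc d))
          W = w + suc (run (2 + d) n)

        -- Column 0 holds `η` alone and the last column holds `η′` alone, so each of them touches
        -- `ρ d` and `ρ (d + 1)`. In the columns 1, ..., w the bar `η′` is absent, which leaves the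
        -- flipped zone open to `ρ (d + 1)` above; in the columns after these the fan lies between
        -- `η` and `η′`.
        host : Diagram
        host = diagram (2 + W)
          (item η 0 W ∷ shift 1 (fan-items w (2 + d) n) ++
           item η′ (suc w) (suc (run (2 + d) n)) ∷ shift 1 (items (flip (J (suc d)))))

        private
          F : Diagram
          F = fan w (2 + d) n

          lower upper : ℕ → List A
          lower i = column (suc i) (item η 0 W ∷ [])
          upper i = column (suc i) (item η′ (suc w) (suc (run (2 + d) n)) ∷ [])

        host-column : ∀ i → col (suc i) host ≡ lower i ++ col i F ++ upper i ++ reverse (col i (J (suc d)))
        host-column i = trans (column-++ (suc i) (item η 0 W ∷ []) _) (cong (lower i ++_)
          (trans (column-++ (suc i) (shift 1 (fan-items w (2 + d) n)) _) (cong₂ _++_ (column-shift 1 i (fan-items w (2 + d) n))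
            (trans (column-++ (suc i) (item η′ (suc w) (suc (run (2 + d) n)) ∷ []) _) (cong (upper i ++_)
              (trans (column-shift 1 i (items (flip (J (suc d))))) (col-flip i (J (suc d)))))))))

        host-first : col 0 host ≡ η ∷ []
        host-first = trans (column-++ 0 (item η 0 W ∷ []) _) (cong₂ _++_ (single-on (z≤n , z≤n))
          (trans (column-++ 0 (shift 1 (fan-items w (2 + d) n)) _)
            (cong₂ _++_ (column-shift-< (s≤s z≤n) (fan-items w (2 + d) n))
              (trans (column-∷-off (shift 1 (items (flip (J (suc d))))) λ ())
                (column-shift-< (s≤s z≤n) (items (flip (J (suc d)))))))))

        lower-on : ∀ {i} → i < W → lower i ≡ η ∷ []
        lower-on i<W = single-on (z≤n , i<W)

        lower-off : ∀ {i} → W ≤ i → lower i ≡ []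
        lower-off W≤i = single-off (λ (_ , q) → 1+n≰n (≤-trans q W≤i))

        upper-on : ∀ {i} → w ≤ i → i ≤ W → upper i ≡ η′ ∷ []
        upper-on w≤i i≤W = single-on (s≤s w≤i , s≤s i≤W)

        upper-off-left : ∀ {i} → i < w → upper i ≡ []
        upper-off-left i<w = single-off (λ (p , _) → <⇒≱ i<w (≤-pred p))

        upper-off-right : ∀ {i} → W < i → upper i ≡ []
        upper-off-right W<i = single-off (λ (_ , q) → <⇒≱ W<i (≤-pred q))

        module _ (narrowJ : ∀ p → Narrow (J p)) where

          private
            narrowF : Narrow F
            narrowF = fan-narrow narrowJ w (2 + d) n

            flipped-off : ∀ {i} → w ≤ i → reverse (col i (J (suc d))) ≡ []
            flipped-off {i} w≤i = cong reverse (narrowJ (suc d) i w≤i)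

          host-left : ∀ {i} → i < w → col (suc i) host ≡ η ∷ ρ (2 + d) ∷ reverse (col i (J (suc d)))
          host-left {i} i<w = trans (host-column i) (cong₂ _++_ (lower-on (≤-trans i<w (m≤m+n w _)))
            (cong₂ _++_ (fan-head (2 + d) n (<⇒≤ i<w)) (cong (_++ _) (upper-off-left i<w))))

          host-middle : ∀ {i} → w ≤ i → i < W → col (suc i) host ≡ η ∷ col i F ++ η′ ∷ []
          host-middle {i} w≤i i<W = trans (host-column i) (cong₂ _++_ (lower-on i<W)
            (cong (col i F ++_) (cong₂ _++_ (upper-on w≤i (<⇒≤ i<W)) (flipped-off w≤i))))

          host-last : col (suc W) host ≡ η′ ∷ []
          host-last = trans (host-column W) (cong₂ _++_ (lower-off ≤-refl) (cong₂ _++_ (narrowF W ≤-refl)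
            (cong₂ _++_ (upper-on (m≤m+n w _) ≤-refl) (flipped-off (m≤m+n w _)))))

          host-narrow : Narrow host
          host-narrow (suc i) (s≤s W<i) = trans (host-column i) (cong₂ _++_ (lower-off W≤i) (cong₂ _++_ (narrowF i W≤i)
            (cong₂ _++_ (upper-off-right W<i) (flipped-off (≤-trans (m≤m+n w _) W≤i)))))
            where W≤i = <⇒≤ W<i

          -- For `p = d + 1` the zone is flipped: its lowest bar, which is to touch `ρ (d + 1)`,
          -- becomes the highest of the host, and its highest bar lies directly on `ρ (d + 2)`. All
          -- other zones are overlaps inside the fan.
          host-reach : ∀ {f g} p → d < p → p ≤ suc d + n → Reach (J p) p f g → Reach host d f g
          host-reach {f} {g} p d<p p≤ r with m≤n⇒m<n∨m≡n d<p
          ... | inj₁ d<<p with fan-reach narrowJ w (2 + d) n p d<<p (s≤s p≤) r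
          ...   | i , next = meet (suc i , Sum.map lift lift next)
            where
            lift : ∀ {u v} → Next u v (col i F) → Next u v (col (suc i) host)
            lift nx = subst (Next _ _) (sym (host-column i)) (next-inside (lower i) _ nx)
          host-reach _ _ _ (below {i} {l} eq) | inj₂ refl = above (η ∷ ρ (2 + d) ∷ reverse l)
            (trans (host-left (occupied {D = J (suc d)} (narrowJ (suc d)) eq))
              (cong (λ z → η ∷ ρ (2 + d) ∷ z) (trans (cong reverse eq) (unfold-reverse _ l))))
          host-reach _ _ _ (above {i} l eq) | inj₂ refl = meet (suc i , inj₂ (η ∷ [] , reverse l ,
            trans (host-left (snoc-occupied (J (suc d)) l (narrowJ (suc d)) eq))
              (cong (λ z → η ∷ ρ (2 + d) ∷ z) (trans (cong reverse eq) (reverse-++ l _)))))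
          host-reach {f} {g} _ _ _ (meet (i , next)) | inj₂ refl = meet (suc i , Sum.[ (λ x → inj₂ (lift x)) , (λ x → inj₁ (lift x)) ] next)
            where
            lift : ∀ {u v} → Next u v (col i (J (suc d))) → Next v u (col (suc i) host)
            lift nx = subst (Next _ _) (sym (trans (host-left (next-occupied (J (suc d)) (narrowJ (suc d)) nx)) (cong (λ z → η ∷ ρ (2 + d) ∷ z) (sym (++-identityʳ _)))))
              (next-inside (η ∷ ρ (2 + d) ∷ []) [] (next-reverse nx))

          host-meets : ∀ k → k ≤ n → Meets host η (ρ (2 + d + k)) × Meets host η′ (ρ (2 + d + k))
          host-meets k k≤n with fan-solo narrowJ w (2 + d) n k k≤n
          ... | i , eq = (suc (w + i) , inj₁ ([] , η′ ∷ [] , c)) , (suc (w + i) , inj₂ (η ∷ [] , [] , c))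
            where
            c : col (suc (w + i)) host ≡ η ∷ ρ (2 + d + k) ∷ η′ ∷ []
            c = trans (host-middle (m≤m+n w i) (occupied {D = F} narrowF eq)) (cong (λ z → η ∷ z ++ η′ ∷ []) eq)

          host-touches : ∀ g → d ≤ g → g ≤ 2 + d + n → Reach host d η g × Reach host d η′ g
          host-touches g d≤g g≤ with split g (2 + d)
          ... | inj₂ (k , refl) with host-meets k (+-cancelˡ-≤ (2 + d) _ _ g≤)
          ...   | p , q = meet p , meet q
          host-touches g d≤g g≤ | inj₁ g<2+d with m≤n⇒m<n∨m≡n d≤g
          ... | inj₂ refl = below {j = 0} host-first , below {j = suc W} host-last
          ... | inj₁ d<g with ≤-antisym d<g (≤-pred g<2+d)
          ...   | refl = above {j = 0} [] host-first , above {j = suc W} [] host-last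

-- Chains of nested blocks and the number of their bars

record Block (A : Set) : Set where
  constructor block
  field
    left right : A
    size-1     : ℕ
open Block public

size : ∀ {A} → List (Block A) → ℕ
size []       = 0
size (b ∷ bs) = suc (size-1 b) + size bs

when : ∀ {A P : Set} → Dec P → Diagram {A} → Diagram {A}
when (yes _) D = D
when (no  _) D = blank

block-labels : {A : Set} → List (Block A) → List A
block-labels []       = []
block-labels (b ∷ bs) = left b ∷ right b ∷ block-labels bs

-- The next block lies between the last two bars that its host touches, so it starts at `d` plus the
-- size of the host.
data Touches {A : Set} : List (Block A) → ℕ → A → ℕ → Set where
  here-left  : ∀ {b bs d g} → d ≤ g → g ≤ 2 + d + size-1 b → Touches (b ∷ bs) d (left b) g
  here-right : ∀ {b bs d g} → d ≤ g → g ≤ 2 + d + size-1 b → Touches (b ∷ bs) d (right b) g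
  there      : ∀ {b bs d f g} → Touches bs (d + suc (size-1 b)) f g → Touches (b ∷ bs) d f g

sumFrom : (ℕ → ℕ) → ℕ → ℕ → ℕ
sumFrom φ s zero    = 0
sumFrom φ s (suc n) = φ s + sumFrom φ (suc s) n

sumFrom-+ : ∀ φ s a b → sumFrom φ s (a + b) ≡ sumFrom φ s a + sumFrom φ (s + a) b
sumFrom-+ φ s zero    b = cong (λ z → sumFrom φ z b) (sym (+-identityʳ s))
sumFrom-+ φ s (suc a) b = trans (cong (φ s +_) (trans (sumFrom-+ φ (suc s) a b)
  (cong (λ z → sumFrom φ (suc s) a + sumFrom φ z b) (sym (+-suc s a))))) (sym (+-assoc (φ s) _ _))

module Counting {A : Set} (_≟A_ : (u v : A) → Dec (u ≡ v)) (v : A) where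

  occurs : List A → ℕ
  occurs l = length (filter (_≟A v) l)

  occurs-++ : ∀ l m → occurs (l ++ m) ≡ occurs l + occurs m
  occurs-++ l m = trans (cong length (filter-++ (_≟A v) l m)) (length-++ (filter (_≟A v) l))

  occurs-∷ : ∀ u l → occurs (u ∷ l) ≡ occurs (u ∷ []) + occurs l
  occurs-∷ u l = occurs-++ (u ∷ []) l

  occurs-reverse : ∀ l → occurs (reverse l) ≡ occurs l
  occurs-reverse []      = refl
  occurs-reverse (u ∷ l) = begin
    occurs (reverse (u ∷ l))               ≡⟨ cong occurs (unfold-reverse u l) ⟩
    occurs (reverse l ++ u ∷ [])           ≡⟨ occurs-++ (reverse l) (u ∷ []) ⟩
    occurs (reverse l) + occurs (u ∷ [])   ≡⟨ cong (_+ occurs (u ∷ [])) (occurs-reverse l) ⟩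
    occurs l + occurs (u ∷ [])             ≡⟨ +-comm (occurs l) _ ⟩
    occurs (u ∷ []) + occurs l             ≡⟨ occurs-∷ u l ⟨
    occurs (u ∷ l)                         ∎
    where open ≡-Reasoning

  count : List Item → ℕ
  count L = occurs (map label L)

  count-++ : ∀ L M → count (L ++ M) ≡ count L + count M
  count-++ L M = trans (cong occurs (map-++ label L M)) (occurs-++ (map label L) (map label M))

  count-∷ : ∀ b L → count (b ∷ L) ≡ occurs (label b ∷ []) + count L
  count-∷ b L = occurs-∷ (label b) (map label L)

  count-shift : ∀ k L → count (shift k L) ≡ count L
  count-shift k L = cong occurs (sym (map-∘ L))

  count-flip : ∀ D → count (items (flip D)) ≡ count (items D)
  count-flip D = trans (cong occurs (reverse-map label (items D))) (occurs-reverse (map label (items D)))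

  count-beside : ∀ D E → count (items (beside D E)) ≡ count (items D) + count (items E)
  count-beside D E = trans (count-++ (items D) _) (cong (count (items D) +_) (count-shift (width D) (items E)))

  count-flat : ∀ l → count (items (flat l)) ≡ occurs l
  count-flat []      = refl
  count-flat (u ∷ l) = trans (count-beside (diagram 1 (item u 0 0 ∷ [])) (flat l))
    (trans (cong (occurs (u ∷ []) +_) (count-flat l)) (sym (occurs-∷ u l)))

module _ {A : Set} (colour : A → Bool) (ρ : ℕ → A) (ρ-true : ∀ h → colour (ρ h) ≡ true) where

  module _ (J : ℕ → Diagram {A}) (zoneJ : ∀ p → Zone colour false (J p)) where

    private
      narrowJ : ∀ p → Narrow (J p)
      narrowJ p = narrow (zoneJ p)

    fan-alternating : ∀ pre h n j → j < pre + suc (run ρ J h n) → Alternating colour true (col j (fan ρ J pre h n))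
    fan-alternating pre h zero j j< = subst (Alternating colour true)
      (sym (fan-head ρ J h zero (≤-pred (≤-trans j< (≤-reflexive (+-comm pre 1)))))) (one (ρ-true h))
    fan-alternating pre h (suc n) j j< with split j (suc pre)
    ... | inj₁ p = subst (Alternating colour true) (sym (fan-head ρ J h (suc n) (≤-pred p))) (one (ρ-true h))
    ... | inj₂ (i , refl) with i <? width (J h)
    ...   | yes p = subst (Alternating colour true) (sym (fan-zone-column ρ J pre h n p))
              (join colour (one (ρ-true h)) (alternating (zoneJ h) i p) (one (ρ-true (suc h))))
    ...   | no ¬p = subst (Alternating colour true) (sym (fan-later-column ρ J pre h n (narrowJ h) (≮⇒≥ ¬p)))
              (fan-alternating (width (J h)) (suc h) n i
                (+-cancelˡ-< (suc pre) _ _ (≤-trans j< (≤-reflexive (+-suc pre _)))))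

    host-zone : ∀ {η η′} d n → colour η ≡ false → colour η′ ≡ false → Zone colour false (host ρ J η η′ d n)
    host-zone {η} {η′} d n cη cη′ = record { narrow = host-narrow ρ J η η′ d n narrowJ ; alternating = alt }
      where
      Alt : List A → Set
      Alt = Alternating colour false
      w W : ℕ
      w = width (J (suc d))
      W = w + suc (run ρ J (2 + d) n)
      alt : ∀ j → j < 2 + W → Alt (col j (host ρ J η η′ d n))
      alt zero    _ = subst Alt (sym (host-first ρ J η η′ d n)) (one cη)
      alt (suc i) (s≤s (s≤s i≤W)) with i <? w | m≤n⇒m<n∨m≡n i≤W
      ... | yes i<w | _ = subst Alt (sym (host-left ρ J η η′ d n narrowJ i<w))
              (cons cη (ρ-true (2 + d)) (reverse-alternating colour (alternating (zoneJ (suc d)) i i<w)))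
      ... | no  i≮w | inj₁ i<W = subst Alt (sym (host-middle ρ J η η′ d n narrowJ (≮⇒≥ i≮w) i<W))
              (join colour (one cη) (fan-alternating w (2 + d) n i i<W) (one cη′))
      ... | no  _   | inj₂ refl = subst Alt (sym (host-last ρ J η η′ d n narrowJ)) (one cη′)

  module _ (F : ℕ → List A) (F-false : ∀ p → All (λ v → colour v ≡ false) (F p)) where

    -- Every zone `p` holds the copies listed in `F p`; the last zone of a block holds the rest of
    -- the chain beside them.
    nest : List (Block A) → ℕ → Diagram
    filling : List (Block A) → ℕ → ℕ → Diagram

    nest []       d = blank
    nest (b ∷ bs) d = host ρ (filling bs (d + suc (size-1 b))) (left b) (right b) d (size-1 b)

    filling bs e p = beside (flat (F p)) (when (p ≟ e) (nest bs e))

    Lower : List (Block A) → Set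
    Lower = All (λ b → colour (left b) ≡ false × colour (right b) ≡ false)

    when-zone : ∀ {P : Set} {D c} (P? : Dec P) → Zone colour c D → Zone colour c (when P? D)
    when-zone (yes _) z = z
    when-zone (no  _) z = blank-zone colour

    nest-zone : ∀ {bs} d → Lower bs → Zone colour false (nest bs d)
    filling-zone : ∀ {bs} e → Lower bs → ∀ p → Zone colour false (filling bs e p)

    nest-zone d []              = blank-zone colour
    nest-zone d ((p , q) ∷ low) = host-zone _ (filling-zone _ low) d _ p q

    filling-zone e low p = beside-zone colour (flat-zone colour (F-false p)) (when-zone (p ≟ e) (nest-zone e low))

    reach-when : ∀ {D d f g} {P : Set} (P? : Dec P) → P → Reach ρ D d f g → Reach ρ (when P? D) d f g
    reach-when (yes _) _ r = r
    reach-when (no ¬p) p r = ⊥-elim (¬p p)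

    nest-step : ∀ {b bs d f g} → Lower (b ∷ bs) → Reach ρ (nest bs (d + suc (size-1 b))) (d + suc (size-1 b)) f g →
      Reach ρ (nest (b ∷ bs) d) d f g
    nest-step {b} {bs} {d} (_ ∷ low) r = host-reach ρ _ _ _ d (size-1 b) (λ p → narrow (filling-zone _ low p))
      (d + suc (size-1 b)) (m<m+n d (s≤s z≤n)) (≤-reflexive (+-suc d (size-1 b)))
      (reach-right ρ _ (flat-narrow (F (d + suc (size-1 b)))) (reach-when (e ≟ e) refl r))
      where e = d + suc (size-1 b)

    nest-touches : ∀ {bs d f g} → Lower bs → Touches bs d f g → Reach ρ (nest bs d) d f g
    nest-touches {b ∷ bs} {d} (_ ∷ low) (here-left p q) =
      proj₁ (host-touches ρ _ (left b) (right b) d (size-1 b) (λ p → narrow (filling-zone _ low p)) _ p q)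
    nest-touches {b ∷ bs} {d} (_ ∷ low) (here-right p q) =
      proj₂ (host-touches ρ _ (left b) (right b) d (size-1 b) (λ p → narrow (filling-zone _ low p)) _ p q)
    nest-touches {b ∷ bs} (l ∷ low) (there t) = nest-step {b} {bs} (l ∷ low) (nest-touches low t)

    nest-fills : ∀ {bs d f} p → Lower bs → d < p → p ≤ d + size bs → f ∈ F p →
      Reach ρ (nest bs d) d f p × Reach ρ (nest bs d) d f (suc p)
    nest-fills {[]} {d} p _ d<p p≤ f∈ = ⊥-elim (<⇒≱ d<p (≤-trans p≤ (≤-reflexive (+-identityʳ d))))
    nest-fills {b ∷ bs} {d} {f} p (l ∷ low) d<p p≤ f∈ with p ≤? d + suc (size-1 b)
    ... | yes p≤e = place (proj₁ both) , place (proj₂ both)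
      where
      both : Reach ρ (flat (F p)) p f p × Reach ρ (flat (F p)) p f (suc p)
      both = reach-flat ρ f∈
      place : ∀ {g} → Reach ρ (flat (F p)) p f g → Reach ρ (nest (b ∷ bs) d) d f g
      place r = host-reach ρ _ _ _ d (size-1 b) (λ p → narrow (filling-zone _ low p)) p d<p
        (≤-trans p≤e (≤-reflexive (+-suc d (size-1 b))))
        (reach-left ρ (when (p ≟ d + suc (size-1 b)) (nest bs (d + suc (size-1 b)))) (flat-narrow (F p)) r)
    ... | no p≰e with nest-fills {bs} p low (≰⇒> p≰e) (≤-trans p≤ (≤-reflexive (sym (+-assoc d _ _)))) f∈
    ...   | r , r′ = nest-step {b} {bs} (l ∷ low) r , nest-step {b} {bs} (l ∷ low) r′

  module _ (_≟A_ : (u v : A) → Dec (u ≡ v)) (v : A) where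

    open Counting _≟A_ v

    module _ (J : ℕ → Diagram {A}) where

      private
        ψ : ℕ → ℕ
        ψ p = count (items (J p)) + occurs (ρ (suc p) ∷ [])

      -- The fan starts at bar `h + 1`, and zone `h` is the one that the host flips. Counting the
      -- two together pairs every zone `p` with the bar `p + 1`.
      count-fan : ∀ pre h n → count (fan-items ρ J pre (suc h) n) + count (items (J h)) ≡ sumFrom ψ h (suc n)
      count-fan pre h zero = e (occurs (ρ (suc h) ∷ [])) _
        where
        e : ∀ x y → x + y ≡ y + x + 0
        e = solve-∀
      count-fan pre h (suc n) = begin
        count (fan-items ρ J pre (suc h) (suc n)) + count (items (J h))
          ≡⟨ cong (_+ count (items (J h))) (count-∷ (item (ρ (suc h)) 0 (pre + width (J (suc h)))) _) ⟩
        occurs (ρ (suc h) ∷ []) + count (shift (suc pre) (items (J (suc h)) ++ rest)) + count (items (J h))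
          ≡⟨ cong (λ z → occurs (ρ (suc h) ∷ []) + z + count (items (J h)))
               (trans (count-shift (suc pre) (items (J (suc h)) ++ rest)) (count-++ (items (J (suc h))) rest)) ⟩
        occurs (ρ (suc h) ∷ []) + (count (items (J (suc h))) + count rest) + count (items (J h))
          ≡⟨ e (occurs (ρ (suc h) ∷ [])) (count (items (J (suc h)))) (count rest) _ ⟩
        ψ h + (count rest + count (items (J (suc h))))
          ≡⟨ cong (ψ h +_) (count-fan (width (J (suc h))) (suc h) n) ⟩
        sumFrom ψ h (suc (suc n)) ∎
        where
        open ≡-Reasoning
        rest = fan-items ρ J (width (J (suc h))) (2 + h) n
        e : ∀ x y z w → x + (y + z) + w ≡ (w + x) + (z + y)
        e = solve-∀

      count-host : ∀ η η′ d n → count (items (host ρ J η η′ d n)) ≡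
        occurs (η ∷ []) + occurs (η′ ∷ []) + sumFrom ψ (suc d) (suc n)
      count-host η η′ d n = begin
        count (items (host ρ J η η′ d n))
          ≡⟨ count-∷ (item η 0 W) _ ⟩
        occurs (η ∷ []) + count (shift 1 fans ++ item η′ (suc w) τ ∷ shift 1 (items (flip (J (suc d)))))
          ≡⟨ cong (occurs (η ∷ []) +_) (trans (count-++ (shift 1 fans) _) (cong₂ _+_ (count-shift 1 fans)
               (trans (count-∷ (item η′ (suc w) τ) _) (cong (occurs (η′ ∷ []) +_)
                 (trans (count-shift 1 (items (flip (J (suc d))))) (count-flip (J (suc d)))))))) ⟩
        occurs (η ∷ []) + (count fans + (occurs (η′ ∷ []) + count (items (J (suc d)))))
          ≡⟨ e (occurs (η ∷ [])) (count fans) (occurs (η′ ∷ [])) (count (items (J (suc d)))) ⟩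
        occurs (η ∷ []) + occurs (η′ ∷ []) + (count fans + count (items (J (suc d))))
          ≡⟨ cong (occurs (η ∷ []) + occurs (η′ ∷ []) +_) (count-fan w (suc d) n) ⟩
        occurs (η ∷ []) + occurs (η′ ∷ []) + sumFrom ψ (suc d) (suc n) ∎
        where
        open ≡-Reasoning
        w = width (J (suc d))
        τ = suc (run ρ J (2 + d) n)
        W = w + τ
        fans = fan-items ρ J w (2 + d) n
        e : ∀ x y z t → x + (y + (z + t)) ≡ x + z + (y + t)
        e = solve-∀

    module _ (F : ℕ → List A) (F-false : ∀ p → All (λ v → colour v ≡ false) (F p)) where

      φ : ℕ → ℕ
      φ p = occurs (F p) + occurs (ρ (suc p) ∷ [])

      -- The inner diagram is drawn in the last of the zones s, …, s + n only.
      count-fillings : ∀ bs s n → sumFrom (λ p → count (items (filling F F-false bs (s + n) p)) + occurs (ρ (suc p) ∷ [])) s (suc n) ≡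
        sumFrom φ s (suc n) + count (items (nest F F-false bs (s + n)))
      count-fillings bs s n = go s n (s + n) refl
        where
        open ≡-Reasoning
        Z = λ e → count (items (nest F F-false bs e))
        term : ∀ e p → count (items (filling F F-false bs e p)) ≡
          occurs (F p) + count (items (when (p ≟ e) (nest F F-false bs e)))
        term e p = trans (count-beside (flat (F p)) (when (p ≟ e) (nest F F-false bs e)))
          (cong (_+ count (items (when (p ≟ e) (nest F F-false bs e)))) (count-flat (F p)))
        last : ∀ {P : Set} (P? : Dec P) → P → ∀ D → count (items (when P? D)) ≡ count (items D)
        last (yes _) _ D = refl
        last (no ¬p) p D = ⊥-elim (¬p p)
        other : ∀ {P : Set} (P? : Dec P) → ¬ P → ∀ D → count (items (when P? D)) ≡ 0
        other (yes p) ¬p D = ⊥-elim (¬p p)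
        other (no _) _ D = refl
        e₁ : ∀ x y z → x + y + z + 0 ≡ x + z + 0 + y
        e₁ = solve-∀
        e₂ : ∀ x y z w → x + 0 + y + (z + w) ≡ x + y + z + w
        e₂ = solve-∀
        go : ∀ s n e → s + n ≡ e →
          sumFrom (λ p → count (items (filling F F-false bs e p)) + occurs (ρ (suc p) ∷ [])) s (suc n) ≡ sumFrom φ s (suc n) + Z e
        go s zero e eq = trans (cong (λ z → z + occurs (ρ (suc s) ∷ []) + 0)
            (trans (term e s) (cong (occurs (F s) +_) (last (s ≟ e) (trans (sym (+-identityʳ s)) eq) _))))
          (e₁ (occurs (F s)) (Z e) _)
        go s (suc n) e eq = trans (cong₂ (λ z t → z + occurs (ρ (suc s) ∷ []) + t)
            (trans (term e s) (cong (occurs (F s) +_) (other (s ≟ e) (λ s≡e → m≢1+m+n s (trans s≡e (trans (sym eq) (+-suc s n)))) _)))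
            (go (suc s) n e (trans (sym (+-suc s n)) eq)))
          (e₂ (occurs (F s)) _ _ (Z e))

      -- The blocks occupy successive stretches of zones without gap or overlap, so their counts
      -- merge into a single sum over all zones.
      count-nest : ∀ bs d → count (items (nest F F-false bs d)) ≡ occurs (block-labels bs) + sumFrom φ (suc d) (size bs)
      count-nest []       d = refl
      count-nest (b ∷ bs) d = begin
        count (items (nest F F-false (b ∷ bs) d))
          ≡⟨ count-host (filling F F-false bs (d + suc n)) (left b) (right b) d n ⟩
        x + x′ + sumFrom (λ p → count (items (filling F F-false bs (d + suc n) p)) + occurs (ρ (suc p) ∷ [])) (suc d) (suc n)
          ≡⟨ cong (x + x′ +_) (subst (λ e → sumFrom (λ p → count (items (filling F F-false bs e p)) + occurs (ρ (suc p) ∷ [])) (suc d) (suc n)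
               ≡ sumFrom φ (suc d) (suc n) + count (items (nest F F-false bs e))) (sym (+-suc d n)) (count-fillings bs (suc d) n)) ⟩
        x + x′ + (sumFrom φ (suc d) (suc n) + count (items (nest F F-false bs (d + suc n))))
          ≡⟨ cong (λ z → x + x′ + (sumFrom φ (suc d) (suc n) + z)) (count-nest bs (d + suc n)) ⟩
        x + x′ + (sumFrom φ (suc d) (suc n) + (z + sumFrom φ (suc (d + suc n)) (size bs)))
          ≡⟨ e x x′ (sumFrom φ (suc d) (suc n)) z (sumFrom φ (suc (d + suc n)) (size bs)) ⟩
        x + (x′ + z) + (sumFrom φ (suc d) (suc n) + sumFrom φ (suc d + suc n) (size bs))
          ≡⟨ cong₂ _+_ (sym (trans (occurs-∷ (left b) _) (cong (x +_) (occurs-∷ (right b) (block-labels bs)))))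
               (sym (sumFrom-+ φ (suc d) (suc n) (size bs))) ⟩
        occurs (block-labels (b ∷ bs)) + sumFrom φ (suc d) (size (b ∷ bs)) ∎
        where
        open ≡-Reasoning
        n = size-1 b
        x = occurs (left b ∷ [])
        x′ = occurs (right b ∷ [])
        z = occurs (block-labels bs)
        e : ∀ x x′ s z t → x + x′ + (s + (z + t)) ≡ x + (x′ + z) + (s + t)
        e = solve-∀

-- From diagrams to representations

module _ {A : Set} where

  first-on : ∀ {j} L (k : Fin (length L)) → On j (lookup L k) → (∀ k′ → k′ Fin.< k → ¬ On j (lookup L k′)) →
    ∃[ l ] column j L ≡ label {A} (lookup L k) ∷ l
  first-on (b ∷ L) zero    o _    = _ , column-∷-on L o
  first-on (b ∷ L) (suc k) o free with first-on L k o (λ k′ k′<k → free (suc k′) (s≤s k′<k))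
  ... | l , eq = l , trans (column-∷-off L (free zero (s≤s z≤n))) eq

  consecutive⇒next : ∀ {j} L (k₁ k₂ : Fin (length L)) → k₁ Fin.< k₂ → On j (lookup L k₁) → On j (lookup L k₂) →
    (∀ k → k₁ Fin.< k → k Fin.< k₂ → ¬ On j (lookup L k)) →
    Next (label {A} (lookup L k₁)) (label (lookup L k₂)) (column j L)
  consecutive⇒next (b ∷ L) zero (suc k₂) _ o₁ o₂ free
    with first-on L k₂ o₂ (λ k k<k₂ → free (suc k) (s≤s z≤n) (s≤s k<k₂))
  ... | l , eq = [] , l , trans (column-∷-on L o₁) (cong (label b ∷_) eq)
  consecutive⇒next {j} (b ∷ L) (suc k₁) (suc k₂) (s≤s k₁<k₂) o₁ o₂ free
    with consecutive⇒next L k₁ k₂ k₁<k₂ o₁ o₂ (λ k p q → free (suc k) (s≤s p) (s≤s q)) | on? j b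
  ... | l₁ , l₂ , eq | yes o = label b ∷ l₁ , l₂ , trans (column-∷-on L o) (cong (label b ∷_) eq)
  ... | l₁ , l₂ , eq | no ¬o = l₁ , l₂ , trans (column-∷-off L ¬o) eq

  head-position : ∀ {j v l} L → column j L ≡ v ∷ l → ∃[ k ]
    (On j (lookup L k) × label {A} (lookup L k) ≡ v × (∀ k′ → k′ Fin.< k → ¬ On j (lookup L k′)))
  head-position {j} [] eq with trans (sym (column-[] j)) eq
  ... | ()
  head-position {j} (b ∷ L) eq with on? j b
  ... | yes o = zero , o , ∷-injectiveˡ (trans (sym (column-∷-on L o)) eq) , (λ _ ())
  ... | no ¬o with head-position L (trans (sym (column-∷-off L ¬o)) eq)
  ...   | k , o , e , free = suc k , o , e , λ { zero _ → ¬o ; (suc k′) (s≤s p) → free k′ p }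

  next⇒consecutive : ∀ {j u v} L → Next u v (column j L) → ∃[ k₁ ] ∃[ k₂ ]
    (k₁ Fin.< k₂ × (On j (lookup L k₁) × label {A} (lookup L k₁) ≡ u) × (On j (lookup L k₂) × label (lookup L k₂) ≡ v) ×
     (∀ k → k₁ Fin.< k → k Fin.< k₂ → ¬ On j (lookup L k)))
  next⇒consecutive {j} [] (l₁ , l₂ , eq) = ⊥-elim (absurd l₁ (trans (sym (column-[] j)) eq))
    where
    absurd : ∀ {u : A} l₁ {l} → ¬ [] ≡ l₁ ++ u ∷ l
    absurd []      ()
    absurd (_ ∷ _) ()
  next⇒consecutive {j} (b ∷ L) (l₁ , l₂ , eq) with on? j b
  next⇒consecutive (b ∷ L) (l₁ , l₂ , eq) | no ¬o
    with next⇒consecutive L (l₁ , l₂ , trans (sym (column-∷-off L ¬o)) eq)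
  ... | k₁ , k₂ , lt , a , c , free = suc k₁ , suc k₂ , s≤s lt , a , c , λ { (suc k) (s≤s p) (s≤s q) → free k p q }
  next⇒consecutive (b ∷ L) ([] , l₂ , eq) | yes o with trans (sym (column-∷-on L o)) eq
  ... | eq′ with head-position L (∷-injectiveʳ eq′)
  ...   | k , o′ , e , free = zero , suc k , s≤s z≤n , (o , ∷-injectiveˡ eq′) , (o′ , e) ,
          λ { (suc k′) _ (s≤s q) → free k′ q }
  next⇒consecutive (b ∷ L) (_ ∷ l₁ , l₂ , eq) | yes o
    with next⇒consecutive L (l₁ , l₂ , ∷-injectiveʳ (trans (sym (column-∷-on L o)) eq))
  ... | k₁ , k₂ , lt , a , c , free = suc k₁ , suc k₂ , s≤s lt , a , c , λ { (suc k) (s≤s p) (s≤s q) → free k p q }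

  alternating-next : ∀ (colour : A → Bool) {c l u v} → Alternating colour c l → Next u v l → colour v ≡ not (colour u)
  alternating-next colour (one _)      ([] , _ , ())
  alternating-next colour (one _)      (_ ∷ [] , _ , ())
  alternating-next colour (one _)      (_ ∷ _ ∷ _ , _ , ())
  alternating-next colour (cons p q a) ([] , _ , refl) = trans q (cong not (sym p))
  alternating-next colour {c} (cons p q a) (_ ∷ [] , _ , refl) = trans (leading a) (trans (sym (not-not c)) (cong not (sym q)))
    where
    leading : ∀ {v l} → Alternating colour c (v ∷ l) → colour v ≡ c
    leading (one p)      = p
    leading (cons p _ _) = p
    not-not : ∀ b → not (not b) ≡ b
    not-not true  = refl
    not-not false = refl
  alternating-next colour (cons p q a) (_ ∷ _ ∷ l₁ , l₂ , refl) = alternating-next colour a (l₁ , l₂ , refl)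

module _ {A B : Set} (f : A → B) where

  -- The bars of a vertex form a mapped list; this recovers the position in the diagram from which a
  -- bar comes.
  at : ∀ xs → Fin (length (map f xs)) → A
  at (x ∷ xs) zero    = x
  at (x ∷ xs) (suc i) = at xs i

  lookup-at : ∀ xs i → lookup (map f xs) i ≡ f (at xs i)
  lookup-at (x ∷ xs) zero    = refl
  lookup-at (x ∷ xs) (suc i) = lookup-at xs i

  at-∈ : ∀ xs i → at xs i ∈ xs
  at-∈ (x ∷ xs) zero    = here refl
  at-∈ (x ∷ xs) (suc i) = there (at-∈ xs i)

  at-surjective : ∀ xs {x} → x ∈ xs → ∃[ i ] at xs i ≡ x
  at-surjective (x ∷ xs) (here refl) = zero , refl
  at-surjective (x ∷ xs) (there x∈)  with at-surjective xs x∈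
  ... | i , eq = suc i , eq

  at-injective : ∀ {xs} → Unique xs → ∀ i j → at xs i ≡ at xs j → i ≡ j
  at-injective (_ ∷ _)   zero    zero    _  = refl
  at-injective {x ∷ xs} (d ∷ _) zero    (suc j) eq = ⊥-elim (All.lookup d (at-∈ xs j) eq)
  at-injective {x ∷ xs} (d ∷ _) (suc i) zero    eq = ⊥-elim (All.lookup d (at-∈ xs i) (sym eq))
  at-injective (_ ∷ u)   (suc i) (suc j) eq = cong suc (at-injective u i j eq)

-- Given directly in lowest terms, so that injectivity is a matter of matching on `refl`.
ι : ℕ → ℚ
ι k = mkℚ (ℤ.+ k) 0 (coprime-sym (1-coprimeTo k))

ι-mono-≤ : ∀ {k l} → k ≤ l → ι k ℚ.≤ ι l
ι-mono-≤ k≤l = *≤* (ℤₚ.*-monoʳ-≤-nonNeg (ℤ.+ 1) (+≤+ k≤l))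

ι-mono-< : ∀ {k l} → k < l → ι k ℚ.< ι l
ι-mono-< k<l = *<* (ℤₚ.*-monoʳ-<-pos (ℤ.+ 1) (+<+ k<l))

ι-cancel-< : ∀ {k l} → ι k ℚ.< ι l → k < l
ι-cancel-< {k} {l} p with k <? l
... | yes q = q
... | no ¬q = ⊥-elim (ℚₚ.<-irrefl refl (ℚₚ.<-≤-trans p (ι-mono-≤ (≮⇒≥ ¬q))))

ι-injective : ∀ {k l} → ι k ≡ ι l → k ≡ l
ι-injective refl = refl

-- Used to find the unit column in which the left side of a channel lies.
floor-between : ∀ {x} s e → ι s ℚ.≤ x → x ℚ.< ι (s + e) → ∃[ j ] (ι j ℚ.≤ x × x ℚ.< ι (suc j))
floor-between {x} s zero    s≤x x<e = ⊥-elim (ℚₚ.<-irrefl refl (ℚₚ.<-≤-trans x<e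
  (subst (λ z → ι z ℚ.≤ x) (sym (+-identityʳ s)) s≤x)))
floor-between {x} s (suc e) s≤x x<e with x ℚₚ.<? ι (suc s)
... | yes p = s , s≤x , p
... | no ¬p = floor-between (suc s) e (ℚₚ.≮⇒≥ ¬p) (subst (λ z → x ℚ.< ι z) (+-suc s e) x<e)

module _ {m n : ℕ} where

  isX : Fin m ⊎ Fin n → Bool
  isX (inj₁ _) = true
  isX (inj₂ _) = false

  isX-adjacent : ∀ v w → isX w ≡ not (isX v) → Adj (K m n) v w
  isX-adjacent (inj₁ _) (inj₂ _) _ = tt
  isX-adjacent (inj₂ _) (inj₁ _) _ = tt

  adjacent-sym : ∀ v w → Adj (K m n) v w → Adj (K m n) w v
  adjacent-sym (inj₁ _) (inj₂ _) _ = tt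
  adjacent-sym (inj₂ _) (inj₁ _) _ = tt

  module _ {t : ℕ} (D : Diagram {Fin m ⊎ Fin n}) (zone : Zone isX false D)
           (meets : ∀ x y → Meets D (inj₂ y) (inj₁ x))
           (few : ∀ v → Counting.count _≟V_ v (items D) ≤ t) where

    private
      L : List Item
      L = items D

      name : Fin (length L) → Fin m ⊎ Fin n
      name k = label (lookup L k)

      -- Heights are positions in the list and hence distinct, which makes all bars disjoint. The
      -- right end is the right edge of the last column occupied.
      toBar : Fin (length L) → Bar
      toBar k = bar (ι (toℕ k)) (ι (start b)) (ι (start b + suc (extra b))) (ι-mono-< (m<m+n (start b) (s≤s z≤n)))
        where b = lookup L k

      positions : Fin m ⊎ Fin n → List (Fin (length L))
      positions v = filter (λ k → name k ≟V v) (allFin (length L))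

      names : map label L ≡ map name (allFin (length L))
      names = sym (trans (map-∘ {g = label} {f = lookup L} (allFin (length L)))
        (cong (map label) (trans (map-tabulate {n = length L} (λ k → k) (lookup L)) (tabulate-lookup L))))

      filter-map-length : ∀ v ks → length (filter (λ k → name k ≟V v) ks) ≡ length (filter (_≟V v) (map name ks))
      filter-map-length v []       = refl
      filter-map-length v (k ∷ ks) with name k ≟V v
      ... | yes _ = cong suc (filter-map-length v ks)
      ... | no  _ = filter-map-length v ks

      length-positions : ∀ v → length (positions v) ≡ Counting.count _≟V_ v L
      length-positions v = trans (filter-map-length v (allFin (length L)))
        (cong (λ l → length (filter (_≟V v) l)) (sym names))

      place : ∀ v → Fin (length (map toBar (positions v))) → Fin (length L)
      place v = at toBar (positions v)

      name-place : ∀ v i → name (place v i) ≡ v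
      name-place v i = proj₂ (∈-filter⁻ (λ k → name k ≟V v) {xs = allFin (length L)} (at-∈ toBar (positions v) i))

      find : ∀ k → ∃[ i ] place (name k) i ≡ k
      find k = at-surjective toBar (positions (name k)) (∈-filter⁺ (λ k′ → name k′ ≟V name k) (∈-allFin k) refl)

      Index : Set
      Index = Σ (Fin m ⊎ Fin n) (λ v → Fin (length (map toBar (positions v))))

      bar-of : Index → Bar
      bar-of (v , i) = lookup (map toBar (positions v)) i

      spot : Index → Fin (length L)
      spot (v , i) = place v i

      bar-spot : ∀ a → bar-of a ≡ toBar (spot a)
      bar-spot (v , i) = lookup-at toBar (positions v) i

      spot-injective : ∀ a b → spot a ≡ spot b → a ≡ b
      spot-injective (v , i) (w , j) eq with trans (sym (name-place v i)) (trans (cong name eq) (name-place w j))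
      ... | refl = cong (v ,_) (at-injective toBar (Uniqueₚ.filter⁺ (λ k → name k ≟V v) (Uniqueₚ.allFin⁺ (length L))) i j eq)

      On⇒≤ : ∀ {j} k → On j (lookup L k) → l (toBar k) ℚ.≤ ι j × ι (suc j) ℚ.≤ r (toBar k)
      On⇒≤ k (p , q) = ι-mono-≤ p , ι-mono-≤ (≤-trans (s≤s q) (≤-reflexive (sym (+-suc _ _))))

      <⇒On : ∀ {j} k → l (toBar k) ℚ.< ι (suc j) → ι j ℚ.< r (toBar k) → On j (lookup L k)
      <⇒On k p q = ≤-pred (ι-cancel-< p) , ≤-pred (≤-trans (ι-cancel-< q) (≤-reflexive (+-suc _ _)))

      -- `SeesUp` for bars instead of indices, so that each bar can be rewritten to its form
      -- `toBar k`.
      Up : Bar → Bar → Set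
      Up a b = y a ℚ.< y b ×
        ∃[ x₁ ] ∃[ x₂ ] (x₁ ℚ.< x₂ × l a ℚ.≤ x₁ × x₂ ℚ.≤ r a × l b ℚ.≤ x₁ × x₂ ℚ.≤ r b ×
          (∀ (c : Index) → ¬ (y a ℚ.< y (bar-of c) × y (bar-of c) ℚ.< y b × l (bar-of c) ℚ.< x₂ × x₁ ℚ.< r (bar-of c))))

      up : ∀ {u v} → (∃[ j ] Next u v (col j D)) → ∃[ i ] ∃[ i′ ] Up (bar-of (u , i)) (bar-of (v , i′))
      up (j , nx) with next⇒consecutive L nx
      ... | k₁ , k₂ , k₁<k₂ , (o₁ , refl) , (o₂ , refl) , free with find k₁ | find k₂
      ...   | i₁ , e₁ | i₂ , e₂ = i₁ , i₂ , subst₂ Up (sym (bar-at i₁ e₁)) (sym (bar-at i₂ e₂))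
        (ι-mono-< k₁<k₂ , ι j , ι (suc j) , ι-mono-< ≤-refl , proj₁ (On⇒≤ k₁ o₁) , proj₂ (On⇒≤ k₁ o₁) ,
         proj₁ (On⇒≤ k₂ o₂) , proj₂ (On⇒≤ k₂ o₂) , blocked)
        where
        bar-at : ∀ {k} i → place (name k) i ≡ k → bar-of (name k , i) ≡ toBar k
        bar-at {k} i e = trans (bar-spot (name k , i)) (cong toBar e)
        blocked : ∀ c → ¬ (ι (toℕ k₁) ℚ.< y (bar-of c) × y (bar-of c) ℚ.< ι (toℕ k₂) ×
                           l (bar-of c) ℚ.< ι (suc j) × ι j ℚ.< r (bar-of c))
        blocked c h with bar-of c | bar-spot c | h
        ... | _ | refl | p , q , s , t = free (spot c) (ι-cancel-< p) (ι-cancel-< q) (<⇒On (spot c) s t)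

      -- The left side of the channel lies in some column `j`, which every bar on it covers in full.
      -- A bar between `a` and `b` in this column would therefore obstruct the channel, so the two
      -- are consecutive there, and their colours differ because columns alternate.
      up⇒adjacent : ∀ a b → Up (bar-of a) (bar-of b) → Adj (K m n) (proj₁ a) (proj₁ b)
      up⇒adjacent a b h with bar-of a | bar-spot a | bar-of b | bar-spot b
      up⇒adjacent a b (ya<yb , x₁ , x₂ , x₁<x₂ , la≤ , ≤ra , lb≤ , ≤rb , free) | _ | refl | _ | refl
        with floor-between (start (lookup L (spot a))) (suc (extra (lookup L (spot a)))) la≤ (ℚₚ.<-≤-trans x₁<x₂ ≤ra)
      ... | j , j≤x₁ , x₁<1+j = subst₂ (Adj (K m n)) (name-place _ (proj₂ a)) (name-place _ (proj₂ b))
            (isX-adjacent _ _ (alternating-next isX (alternating zone j in-range) nx))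
        where
        on : ∀ k → l (toBar k) ℚ.≤ x₁ → x₂ ℚ.≤ r (toBar k) → On j (lookup L k)
        on k p q = <⇒On k (ℚₚ.≤-<-trans p x₁<1+j) (ℚₚ.≤-<-trans j≤x₁ (ℚₚ.<-≤-trans x₁<x₂ q))
        nx : Next (name (spot a)) (name (spot b)) (col j D)
        nx = consecutive⇒next L (spot a) (spot b) (ι-cancel-< ya<yb) (on (spot a) la≤ ≤ra) (on (spot b) lb≤ ≤rb)
          λ k a<k k<b o → let i , e = find k ; eq = trans (bar-spot (name k , i)) (cong toBar e) in
            free (name k , i) (subst (λ z → ι (toℕ (spot a)) ℚ.< y z × y z ℚ.< ι (toℕ (spot b)) × l z ℚ.< x₂ × x₁ ℚ.< r z) (sym eq)
              (ι-mono-< a<k , ι-mono-< k<b , ℚₚ.≤-<-trans (proj₁ (On⇒≤ k o)) (ℚₚ.≤-<-trans j≤x₁ x₁<x₂) ,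
               ℚₚ.<-≤-trans x₁<1+j (proj₂ (On⇒≤ k o))))
        in-range : j < width D
        in-range = next-occupied D (narrow zone) nx

    diagram⇒representation : BarRep (K m n) t
    diagram⇒representation = record
      { bars      = λ v → map toBar (positions v)
      ; atMostT   = λ v → ≤-trans (≤-reflexive (trans (length-map toBar (positions v)) (length-positions v))) (few v)
      ; disjoint  = λ a b a≢b → inj₁ λ eq → a≢b (spot-injective a b
          (Finₚ.toℕ-injective (ι-injective (trans (cong y (sym (bar-spot a))) (trans eq (cong y (bar-spot b)))))))
      ; adj⇒sees  = λ v w _ → sees v w
      ; sees⇒adj  = λ { v w _ i j (inj₁ h) → up⇒adjacent (v , i) (w , j) h
                      ; v w _ i j (inj₂ h) → adjacent-sym w v (up⇒adjacent (w , j) (v , i) h) } }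
      where
      See : (v w : Fin m ⊎ Fin n) → Set
      See v w = ∃[ i ] ∃[ j ] (Up (bar-of (v , i)) (bar-of (w , j)) ⊎ Up (bar-of (w , j)) (bar-of (v , i)))
      both : ∀ x y → See (inj₂ y) (inj₁ x)
      both x y with meets x y
      ... | j , inj₁ nx with up (j , nx)
      ...   | i , i′ , h = i , i′ , inj₁ h
      both x y | j , inj₂ nx with up (j , nx)
      ...   | i , i′ , h = i′ , i , inj₂ h
      sees : ∀ v w → Adj (K m n) v w → See v w
      sees (inj₂ y) (inj₁ x) _ = both x y
      sees (inj₁ x) (inj₂ y) _ with both x y
      ... | i , j , h = j , i , Sum.swap h

-- Counting bars

sumFrom-mono : ∀ {φ χ : ℕ → ℕ} → (∀ p → φ p ≤ χ p) → ∀ s n → sumFrom φ s n ≤ sumFrom χ s n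
sumFrom-mono le s zero    = z≤n
sumFrom-mono le s (suc n) = +-mono-≤ (le s) (sumFrom-mono le (suc s) n)

sumFrom-add : ∀ (φ χ : ℕ → ℕ) s n → sumFrom (λ p → φ p + χ p) s n ≡ sumFrom φ s n + sumFrom χ s n
sumFrom-add φ χ s zero    = refl
sumFrom-add φ χ s (suc n) = trans (cong (φ s + χ s +_) (sumFrom-add φ χ (suc s) n)) (e (φ s) (χ s) _ _)
  where
  e : ∀ a b c d → a + b + (c + d) ≡ a + c + (b + d)
  e = solve-∀

sumFrom-zero : ∀ (φ : ℕ → ℕ) s n → (∀ p → s ≤ p → p < s + n → φ p ≡ 0) → sumFrom φ s n ≡ 0
sumFrom-zero φ s zero    z = refl
sumFrom-zero φ s (suc n) z = cong₂ _+_ (z s ≤-refl (m<m+n s (s≤s z≤n)))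
  (sumFrom-zero φ (suc s) n (λ p s<p p< → z p (<⇒≤ s<p) (≤-trans p< (≤-reflexive (sym (+-suc s n))))))

sumFrom≤1 : ∀ (φ : ℕ → ℕ) s n → (∀ p → φ p ≤ 1) →
  (∀ p q → s ≤ p → p < q → q < s + n → φ p ≡ 0 ⊎ φ q ≡ 0) → sumFrom φ s n ≤ 1
sumFrom≤1 φ s zero    le alone = z≤n
sumFrom≤1 φ s (suc n) le alone with φ s in eq | le s
... | zero        | _ = sumFrom≤1 φ (suc s) n le (λ p q s<p p<q q< → alone p q (<⇒≤ s<p) p<q (≤-trans q< (≤-reflexive (sym (+-suc s n)))))
... | suc zero    | _ = ≤-reflexive (cong suc (sumFrom-zero φ (suc s) n other))
  where
  other : ∀ p → suc s ≤ p → p < suc s + n → φ p ≡ 0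
  other p s<p p< with alone s p ≤-refl s<p (≤-trans p< (≤-reflexive (sym (+-suc s n))))
  ... | inj₁ z = ⊥-elim (0≢1+n (trans (sym z) eq))
  ... | inj₂ z = z
... | suc (suc _) | s≤s ()

-- A union bound: what sits at `pos k` is split off, and the rest sits at `pos 0, …, pos (k − 1)`.
-- It bounds the copies of a pair by the number of zones assigned to the pair.
sumFrom-positions : ∀ (pos : ℕ → ℕ) k (χ : ℕ → ℕ) s n → (∀ p → χ p ≤ 1) →
  (∀ p → χ p ≡ 0 ⊎ ∃[ i ] (i < k × pos i ≡ p)) → sumFrom χ s n ≤ k
sumFrom-positions pos zero    χ s n le hit = ≤-reflexive (sumFrom-zero χ s n none)
  where
  none : ∀ p → s ≤ p → p < s + n → χ p ≡ 0
  none p _ _ with hit p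
  ... | inj₁ z = z
  ... | inj₂ (_ , () , _)
sumFrom-positions pos (suc k) χ s n le hit = begin
  sumFrom χ s n                                ≤⟨ sumFrom-mono splits s n ⟩
  sumFrom (λ p → here? p + other p) s n        ≡⟨ sumFrom-add here? other s n ⟩
  sumFrom here? s n + sumFrom other s n        ≤⟨ +-mono-≤ (sumFrom≤1 here? s n here≤1 alone)
                                                   (sumFrom-positions pos k other s n other≤1 other-hit) ⟩
  suc k                                        ∎
  where
  open ≤-Reasoning
  here? other : ℕ → ℕ
  here? p with pos k ≟ p
  ... | yes _ = 1
  ... | no  _ = 0
  other p with pos k ≟ p
  ... | yes _ = 0
  ... | no  _ = χ p
  splits : ∀ p → χ p ≤ here? p + other p
  splits p with pos k ≟ p
  ... | yes _ = le p
  ... | no  _ = ≤-refl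
  here≤1 : ∀ p → here? p ≤ 1
  here≤1 p with pos k ≟ p
  ... | yes _ = ≤-refl
  ... | no  _ = z≤n
  alone : ∀ p q → s ≤ p → p < q → q < s + n → here? p ≡ 0 ⊎ here? q ≡ 0
  alone p q _ p<q _ with pos k ≟ p | pos k ≟ q
  ... | no _     | _        = inj₁ refl
  ... | yes _    | no _     = inj₂ refl
  ... | yes refl | yes refl = ⊥-elim (<-irrefl refl p<q)
  other≤1 : ∀ p → other p ≤ 1
  other≤1 p with pos k ≟ p
  ... | yes _ = z≤n
  ... | no  _ = le p
  other-hit : ∀ p → other p ≡ 0 ⊎ ∃[ i ] (i < k × pos i ≡ p)
  other-hit p with pos k ≟ p
  ... | yes _ = inj₁ refl
  ... | no ¬e with hit p
  ...   | inj₁ z = inj₁ z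
  ...   | inj₂ (i , i≤k , e) with m≤n⇒m<n∨m≡n (≤-pred i≤k)
  ...     | inj₁ i<k  = inj₂ (i , i<k , e)
  ...     | inj₂ refl = ⊥-elim (¬e e)

-- Since bar h belongs to the vertex h mod m, this gives each vertex of X at most one of any m
-- consecutive bars.
same-remainder : ∀ m .{{_ : NonZero m}} {p q} → p < q → p % m ≡ q % m → p + m ≤ q
same-remainder m {p} {q} p<q eq with p / m <? q / m
... | yes p/m<q/m = begin
      p + m                        ≡⟨ cong (_+ m) (m≡m%n+[m/n]*n p m) ⟩
      p % m + p / m * m + m        ≡⟨ e (p % m) (p / m * m) m ⟩
      p % m + (m + p / m * m)      ≤⟨ +-mono-≤ (≤-reflexive eq) (*-monoˡ-≤ m p/m<q/m) ⟩
      q % m + q / m * m            ≡⟨ m≡m%n+[m/n]*n q m ⟨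
      q                            ∎
      where
      open ≤-Reasoning
      e : ∀ a b c → a + b + c ≡ a + (c + b)
      e = solve-∀
... | no ¬lt = ⊥-elim (<⇒≱ p<q (begin
      q                            ≡⟨ m≡m%n+[m/n]*n q m ⟩
      q % m + q / m * m            ≤⟨ +-mono-≤ (≤-reflexive (sym eq)) (*-monoˡ-≤ m (≮⇒≥ ¬lt)) ⟩
      p % m + p / m * m            ≡⟨ m≡m%n+[m/n]*n p m ⟨
      p                            ∎))
      where open ≤-Reasoning

module _ {A : Set} (_≟A_ : (u v : A) → Dec (u ≡ v)) (v : A) where
  open Counting _≟A_ v

  occurs-∉ : ∀ {l} → v ∉ l → occurs l ≡ 0
  occurs-∉ {[]}    _  = refl
  occurs-∉ {u ∷ l} ∉l with u ≟A v
  ... | yes refl = ⊥-elim (∉l (here refl))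
  ... | no  _    = occurs-∉ (λ i → ∉l (there i))

  occurs-unique : ∀ {l} → Unique l → occurs l ≤ 1
  occurs-unique []      = z≤n
  occurs-unique {u ∷ l} (d ∷ un) with u ≟A v
  ... | yes refl = ≤-reflexive (cong suc (occurs-∉ (λ i → All.lookup d i refl)))
  ... | no  _    = occurs-unique un

  occurs-one : ∀ u → occurs (u ∷ []) ≤ 1
  occurs-one u = occurs-unique ([] ∷ [])

  occurs-≢ : ∀ {u} → u ≢ v → occurs (u ∷ []) ≡ 0
  occurs-≢ {u} u≢v = occurs-∉ {u ∷ []} λ { (here e) → u≢v (sym e) }

-- Representations from an assignment of copies to zones

module _ {m s : ℕ} .{{_ : NonZero m}} where

  Y : Fin s → Fin 2 → Fin m ⊎ Fin (s * 2)
  Y τ b = inj₂ (combine τ b)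

  Y-injective : ∀ {τ τ′ b b′} → Y τ b ≡ Y τ′ b′ → τ ≡ τ′ × b ≡ b′
  Y-injective {τ} {τ′} {b} {b′} eq = Finₚ.combine-injective τ b τ′ b′ (Sumₚ.inj₂-injective eq)

  row : ℕ → Fin m ⊎ Fin (s * 2)
  row h = inj₁ (h mod m)

  hosts : ∀ {k} → (Fin k → Fin s) → (Fin k → ℕ) → List (Block (Fin m ⊎ Fin (s * 2)))
  hosts f sz = tabulate (λ i → block (Y (f i) zero) (Y (f i) (suc zero)) (sz i))

  hosts-lower : ∀ {k} (f : Fin k → Fin s) sz →
    All (λ b → isX (left b) ≡ false × isX (right b) ≡ false) (hosts f sz)
  hosts-lower f sz = Allₚ.tabulate⁺ (λ i → refl , refl)

  ∈-host-labels : ∀ {k} (f : Fin k → Fin s) sz {v} → v ∈ block-labels (hosts f sz) → ∃[ i ] ∃[ b ] v ≡ Y (f i) b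
  ∈-host-labels {suc k} f sz (here eq)         = zero , zero , eq
  ∈-host-labels {suc k} f sz (there (here eq)) = zero , suc zero , eq
  ∈-host-labels {suc k} f sz (there (there v∈)) with ∈-host-labels (λ i → f (suc i)) (λ i → sz (suc i)) v∈
  ... | i , b , eq = suc i , b , eq

  host-labels-unique : ∀ {k} (f : Fin k → Fin s) sz → (∀ {i j} → f i ≡ f j → i ≡ j) → Unique (block-labels (hosts f sz))
  host-labels-unique {zero}  f sz inj = []
  host-labels-unique {suc k} f sz inj =
    ((λ eq → Finₚ.0≢1+n (proj₂ (Y-injective {f zero} {f zero} eq))) ∷ All.tabulate (fresh zero)) ∷
    All.tabulate (fresh (suc zero)) ∷
    host-labels-unique (λ i → f (suc i)) (λ i → sz (suc i)) (λ eq → Finₚ.suc-injective (inj eq))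
    where
    fresh : ∀ b {v} → v ∈ block-labels (hosts (λ i → f (suc i)) (λ i → sz (suc i))) → Y (f zero) b ≢ v
    fresh b v∈ refl with ∈-host-labels (λ i → f (suc i)) (λ i → sz (suc i)) v∈
    ... | i , b′ , eq = Finₚ.0≢1+n (inj (proj₁ (Y-injective {f zero} {f (suc i)} eq)))

  -- Q p τ: the pair τ is drawn between the bars p and p + 1.
  module _ {Q : ℕ → Fin s → Set} (Q? : ∀ p τ → Dec (Q p τ)) where

    private
      half : Fin (s * 2) → Fin s
      half k = proj₁ (remQuot {s} 2 k)

    filler : ℕ → List (Fin m ⊎ Fin (s * 2))
    filler p = map inj₂ (filter (λ k → Q? p (half k)) (allFin (s * 2)))

    filler-lower : ∀ p → All (λ v → isX {m} v ≡ false) (filler p)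
    filler-lower p = Allₚ.map⁺ (All.tabulate (λ _ → refl))

    filler-unique : ∀ p → Unique (filler p)
    filler-unique p = Uniqueₚ.map⁺ Sumₚ.inj₂-injective (Uniqueₚ.filter⁺ (λ k → Q? p (half k)) (Uniqueₚ.allFin⁺ (s * 2)))

    ∈-filler : ∀ {p τ} b → Q p τ → Y τ b ∈ filler p
    ∈-filler {p} {τ} b q = ∈-map⁺ inj₂ (∈-filter⁺ (λ k → Q? p (half k)) (∈-allFin (combine τ b))
      (subst (Q p) (sym (cong proj₁ (Finₚ.remQuot-combine τ b))) q))

    filler-∈ : ∀ {p τ} b → Y τ b ∈ filler p → Q p τ
    filler-∈ {p} {τ} b y∈ with ∈-map⁻ inj₂ y∈
    ... | k , k∈ , refl = subst (Q p) (cong proj₁ (Finₚ.remQuot-combine τ b))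
      (proj₂ (∈-filter⁻ (λ k → Q? p (half k)) {xs = allFin (s * 2)} k∈))

    row∉filler : ∀ {p x} → inj₁ x ∉ filler p
    row∉filler x∈ with ∈-map⁻ inj₂ x∈
    ... | _ , _ , ()

    -- `short` leaves at most t bars to each vertex of X. In `rare`, `u` bounds the copies of a
    -- pair, and the bar in its own block, if it has one, counts as one more. In `covered`, the bar
    -- `h` of the vertex x is touched by the block of τ or bounds a zone with a copy of τ; `h` is at
    -- least 2 because the bars 0 and 1 are not drawn.
    module _ {k t : ℕ} (f : Fin k → Fin s) (sz : Fin k → ℕ) (f-injective : ∀ {i j} → f i ≡ f j → i ≡ j)
             (short : size (hosts f sz) ≤ t * m)
             (rare : ∀ τ → ∃[ u ] Σ (ℕ → ℕ) λ pos →
               (∀ p → Q p τ → ∃[ i ] (i < u × pos i ≡ p)) × (u < t ⊎ u ≤ t × (∀ i → f i ≢ τ)))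
             (covered : ∀ x τ → ∃[ h ] (2 ≤ h × h mod m ≡ x ×
               ((∀ b → Touches (hosts f sz) 0 (Y τ b) h) ⊎
                ∃[ p ] (1 ≤ p × p ≤ size (hosts f sz) × Q p τ × (h ≡ p ⊎ h ≡ suc p))))) where

      private
        D : Diagram {Fin m ⊎ Fin (s * 2)}
        D = nest isX row (λ _ → refl) filler filler-lower (hosts f sz) 0

        reach⇒meets : ∀ {v h} → 2 ≤ h → Reach row D 0 v h → Meets D v (row h)
        reach⇒meets ()       (below _)
        reach⇒meets (s≤s ()) (above _ _)
        reach⇒meets _        (meet h) = h

        meets : ∀ x y → Meets D (inj₂ y) (inj₁ x)
        meets x y with covered x (half y)
        ... | h , 2≤h , refl , c = subst (λ v → Meets D v (row h)) y≡ (reach⇒meets 2≤h (reach c))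
          where
          b = proj₂ (remQuot {s} 2 y)
          y≡ : Y (half y) b ≡ inj₂ y
          y≡ = cong inj₂ (Finₚ.combine-remQuot {s} 2 y)
          reach : _ → Reach row D 0 (Y (half y) b) h
          reach (inj₁ t) = nest-touches isX row (λ _ → refl) filler filler-lower (hosts-lower f sz) (t b)
          reach (inj₂ (p , 1≤p , p≤ , q , inj₁ refl)) =
            proj₁ (nest-fills isX row (λ _ → refl) filler filler-lower p (hosts-lower f sz) 1≤p p≤ (∈-filler b q))
          reach (inj₂ (p , 1≤p , p≤ , q , inj₂ refl)) =
            proj₂ (nest-fills isX row (λ _ → refl) filler filler-lower p (hosts-lower f sz) 1≤p p≤ (∈-filler b q))

        total-count : ∀ v → Counting.count _≟V_ v (items D) ≡ Counting.occurs _≟V_ v (block-labels (hosts f sz)) +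
          sumFrom (λ p → Counting.occurs _≟V_ v (filler p) + Counting.occurs _≟V_ v (row (suc p) ∷ [])) 1 (size (hosts f sz))
        total-count v = count-nest isX row (λ _ → refl) _≟V_ v filler filler-lower (hosts f sz) 0

        rows-few : ∀ (χ : ℕ → ℕ) → (∀ p → χ p ≤ 1) → (∀ p q → p < q → q < p + m → χ p ≡ 0 ⊎ χ q ≡ 0) →
          ∀ u a → sumFrom χ a (u * m) ≤ u
        rows-few χ le alone zero    a = z≤n
        rows-few χ le alone (suc u) a = ≤-trans (≤-reflexive (sumFrom-+ χ a m (u * m)))
          (+-mono-≤ (sumFrom≤1 χ a m le (λ p q a≤p p<q q< → alone p q p<q (≤-trans q< (+-monoˡ-≤ m a≤p))))
                    (rows-few χ le alone u (a + m)))

        few : ∀ v → Counting.count _≟V_ v (items D) ≤ t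
        few (inj₁ x) = begin
          Counting.count _≟V_ (inj₁ x) (items D)    ≡⟨ total-count (inj₁ x) ⟩
          occ (block-labels (hosts f sz)) + sumFrom (λ p → occ (filler p) + occ (row (suc p) ∷ [])) 1 H
            ≤⟨ +-mono-≤ (≤-reflexive (occurs-∉ _≟V_ (inj₁ x) none))
                 (sumFrom-mono (λ p → ≤-reflexive (cong (_+ occ (row (suc p) ∷ [])) (occurs-∉ _≟V_ (inj₁ x) row∉filler))) 1 H) ⟩
          -- The sum is extended to t full periods of length m.
          sumFrom χ 1 H                             ≤⟨ m≤m+n _ _ ⟩
          sumFrom χ 1 H + sumFrom χ (1 + H) (t * m ∸ H)
                                                    ≡⟨ sumFrom-+ χ 1 H (t * m ∸ H) ⟨
          sumFrom χ 1 (H + (t * m ∸ H))             ≡⟨ cong (sumFrom χ 1) (m+[n∸m]≡n short) ⟩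
          sumFrom χ 1 (t * m)                       ≤⟨ rows-few χ (λ p → occurs-one _≟V_ (inj₁ x) (row (suc p))) alone t 1 ⟩
          t                                         ∎
          where
          open ≤-Reasoning
          H = size (hosts f sz)
          occ = Counting.occurs _≟V_ (inj₁ x)
          χ : ℕ → ℕ
          χ p = occ (row (suc p) ∷ [])
          none : inj₁ x ∉ block-labels (hosts f sz)
          none x∈ with ∈-host-labels f sz x∈
          ... | _ , _ , ()
          alone : ∀ p q → p < q → q < p + m → χ p ≡ 0 ⊎ χ q ≡ 0
          alone p q p<q q< = pick ((suc p mod m) Finₚ.≟ x)
            where
            pick : Dec (suc p mod m ≡ x) → χ p ≡ 0 ⊎ χ q ≡ 0
            pick (no ¬e) = inj₁ (occurs-≢ _≟V_ (inj₁ x) {row (suc p)} (λ eq → ¬e (Sumₚ.inj₁-injective eq)))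
            pick (yes e) = inj₂ (occurs-≢ _≟V_ (inj₁ x) {row (suc q)} (λ eq → <⇒≱ q< (≤-pred (same-remainder m (s≤s p<q)
              (trans (sym (Finₚ.toℕ-fromℕ< (m%n<n (suc p) m))) (trans (cong toℕ (trans e (sym (Sumₚ.inj₁-injective eq))))
                (Finₚ.toℕ-fromℕ< (m%n<n (suc q) m))))))))
        few (inj₂ y) = subst (λ v → Counting.count _≟V_ v (items D) ≤ t)
          (cong inj₂ (Finₚ.combine-remQuot {s} 2 y)) (go (half y) (proj₂ (remQuot {s} 2 y)))
          where
          go : ∀ τ b → Counting.count _≟V_ (Y τ b) (items D) ≤ t
          go τ b with rare τ
          ... | u , pos , at-pos , choice = begin
            Counting.count _≟V_ (Y τ b) (items D)       ≡⟨ total-count (Y τ b) ⟩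
            occ (block-labels (hosts f sz)) + sumFrom (λ p → occ (filler p) + occ (row (suc p) ∷ [])) 1 H
              ≤⟨ +-monoʳ-≤ (occ (block-labels (hosts f sz)))
                   (sumFrom-mono (λ p → ≤-reflexive (trans (cong (occ (filler p) +_) (occurs-≢ _≟V_ (Y τ b) {row (suc p)} λ ())) (+-identityʳ _))) 1 H) ⟩
            occ (block-labels (hosts f sz)) + sumFrom (λ p → occ (filler p)) 1 H
              ≤⟨ +-monoʳ-≤ (occ (block-labels (hosts f sz))) (sumFrom-positions pos u (λ p → occ (filler p)) 1 H
                   (λ p → occurs-unique _≟V_ (Y τ b) (filler-unique p)) hit) ⟩
            occ (block-labels (hosts f sz)) + u         ≤⟨ choose choice ⟩
            t                                           ∎
            where
            open ≤-Reasoning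
            H = size (hosts f sz)
            occ = Counting.occurs _≟V_ (Y τ b)
            hit : ∀ p → occ (filler p) ≡ 0 ⊎ ∃[ i ] (i < u × pos i ≡ p)
            hit p with Q? p τ
            ... | yes q = inj₂ (at-pos p q)
            ... | no ¬q = inj₁ (occurs-∉ _≟V_ (Y τ b) (λ y∈ → ¬q (filler-∈ b y∈)))
            choose : u < t ⊎ u ≤ t × (∀ i → f i ≢ τ) → occ (block-labels (hosts f sz)) + u ≤ t
            choose (inj₁ u<t) = ≤-trans (+-monoˡ-≤ u (occurs-unique _≟V_ (Y τ b) (host-labels-unique f sz f-injective))) u<t
            choose (inj₂ (u≤t , not-host)) = ≤-trans (+-monoˡ-≤ u (≤-reflexive (occurs-∉ _≟V_ (Y τ b) none))) u≤t
              where
              none : Y τ b ∉ block-labels (hosts f sz)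
              none y∈ with ∈-host-labels f sz y∈
              ... | i , b′ , eq = not-host i (sym (proj₁ (Y-injective {τ} {f i} eq)))

      arrangement : BarRep (K m (s * 2)) t
      arrangement = diagram⇒representation D
        (nest-zone isX row (λ _ → refl) filler filler-lower 0 (hosts-lower f sz)) meets few

-- The choice of parameters

halve : ∀ u → ∃[ i ] (u ≡ 2 * i ⊎ u ≡ suc (2 * i))
halve zero    = 0 , inj₁ refl
halve (suc u) with halve u
... | i , inj₁ refl = i , inj₂ refl
... | i , inj₂ refl = suc i , inj₁ (e i)
  where
  e : ∀ i → suc (suc (2 * i)) ≡ 2 * suc i
  e = solve-∀

module _ {m : ℕ} .{{_ : NonZero m}} where

  mod-cong : ∀ {a b} → a % m ≡ b % m → a mod m ≡ b mod m
  mod-cong {a} {b} eq = Finₚ.toℕ-injective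
    (trans (Finₚ.toℕ-fromℕ< (m%n<n a m)) (trans eq (sym (Finₚ.toℕ-fromℕ< (m%n<n b m)))))

  mod-+m : ∀ a → (a + m) mod m ≡ a mod m
  mod-+m a = mod-cong ([m+n]%n≡m%n a m)

  mod-+% : ∀ k w → (k + w % m) mod m ≡ (k + w) mod m
  mod-+% k w = mod-cong (trans (%-distribˡ-+ k (w % m) m)
    (trans (cong (λ z → (k % m + z) % m) (m%n%n≡m%n w m)) (sym (%-distribˡ-+ k w m))))

residue : ∀ {m} .{{_ : NonZero m}} base (x : Fin m) → ∃[ e ] (e < m × (base + e) mod m ≡ x)
residue {m} zero x = toℕ x , Finₚ.toℕ<n x ,
  Finₚ.toℕ-injective (trans (Finₚ.toℕ-fromℕ< (m%n<n (toℕ x) m)) (m<n⇒m%n≡m (Finₚ.toℕ<n x)))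
residue (suc base) x with residue base x
residue (suc base) x | suc e , e<m , eq = e , <⇒≤ e<m , trans (cong (_mod _) (sym (+-suc base e))) eq
residue {suc m′} (suc base) x | zero , _ , eq = m′ , ≤-refl ,
  trans (cong (_mod suc m′) (sym (+-suc base m′)))
    (trans (mod-+m base) (trans (cong (_mod suc m′) (sym (+-identityʳ base))) eq))

module _ {m s : ℕ} .{{_ : NonZero m}} where

  host-touch : ∀ {bs d h c} (τ : Fin s) → d ≤ h → h ≤ 2 + d + c → ∀ b →
    Touches (block (Y {m} {s} τ zero) (Y {m} {s} τ (suc zero)) c ∷ bs) d (Y {m} {s} τ b) h
  host-touch τ p q zero       = here-left p q
  host-touch τ p q (suc zero) = here-right p q

  later-touch : ∀ {k} (f : Fin k → Fin s) a d i {h} → d + suc a * toℕ i ≤ h → h ≤ 2 + (d + suc a * toℕ i) + a → ∀ b →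
    Touches (hosts {m} {s} f (λ _ → a)) d (Y {m} {s} (f i) b) h
  later-touch f a d zero {h} p q = host-touch (f zero) (subst (_≤ h) e p) (subst (λ z → h ≤ 2 + z + a) e q)
    where
    e : d + suc a * 0 ≡ d
    e = trans (cong (d +_) (*-zeroʳ (suc a))) (+-identityʳ d)
  later-touch f a d (suc i) {h} p q b = there (later-touch (λ j → f (suc j)) a (d + suc a) i
    (subst (_≤ h) (e a d (toℕ i)) p) (subst (λ z → h ≤ 2 + z + a) (e a d (toℕ i)) q) b)
    where
    e : ∀ a d i → d + suc a * suc i ≡ d + suc a + suc a * i
    e = solve-∀

  size-hosts : ∀ {k} (f : Fin k → Fin s) a → size (hosts {m} {s} f (λ _ → a)) ≡ k * suc a
  size-hosts {zero}  f a = refl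
  size-hosts {suc k} f a = cong (suc a +_) (size-hosts (λ i → f (suc i)) a)

-- The pair `zero` has the only block, which encloses all m vertices of X. The other pairs have no
-- block and can afford t copies each, which touch 2t ≥ m bars.
module Few-rows {m′ s′ t : ℕ} (m≤2t : suc m′ ≤ 2 * t) where

  private
    m s : ℕ
    m = suc m′
    s = suc s′

    1≤t : 1 ≤ t
    1≤t = *-cancelˡ-< 2 0 t (≤-trans (s≤s z≤n) m≤2t)

  -- The copies take the bars 2, ..., m + 1 two at a time from the top. For odd m this ends with
  -- zone 1, in which only the bar 2 is drawn. For larger i the truncated difference is 0, which is
  -- not a zone.
  Q : ℕ → Fin s → Set
  Q p τ = τ ≢ zero × ∃[ i ] (i < t × m ∸ 2 * i ≡ p)

  Q? : ∀ p τ → Dec (Q p τ)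
  Q? p τ = ¬? (τ Finₚ.≟ zero) ×-dec anyUpTo? (λ i → m ∸ 2 * i ≟ p) t

  root : Fin 1 → Fin s
  root _ = zero

  covered : ∀ (x : Fin m) τ → ∃[ h ] (2 ≤ h × h mod m ≡ x ×
    ((∀ b → Touches (hosts {m} {s} root (λ _ → m′)) 0 (Y {m} {s} τ b) h) ⊎
     ∃[ p ] (1 ≤ p × p ≤ size (hosts {m} {s} root (λ _ → m′)) × Q p τ × (h ≡ p ⊎ h ≡ suc p))))
  covered x τ with residue 2 x
  covered x zero    | e , e<m , eq = 2 + e , s≤s (s≤s z≤n) , eq , inj₁ (host-touch {m} {s} zero z≤n (s≤s (s≤s (≤-pred e<m))))
  -- `m′ ∸ e` is the distance from the bar `2 + e` up to the top bar `m + 1`; its parity tells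
  -- whether the bar is the upper or the lower one of its zone.
  covered x (suc τ) | e , e<m , eq with halve (m′ ∸ e)
  ... | i , parity = 2 + e , s≤s (s≤s z≤n) , eq , inj₂ (m ∸ 2 * i , m<n⇒0<n∸m (s≤s 2i≤m′) ,
        ≤-trans (m∸n≤m m (2 * i)) (≤-reflexive (cong suc (sym (+-identityʳ m′)))) ,
        ((λ ()) , i , *-cancelˡ-< 2 i t (≤-trans (s≤s 2i≤m′) m≤2t) , refl) , position parity)
    where
    m′≡ : m′ ≡ e + (m′ ∸ e)
    m′≡ = sym (m+[n∸m]≡n (≤-pred e<m))
    2i≤u : ∀ {u} → u ≡ 2 * i ⊎ u ≡ suc (2 * i) → 2 * i ≤ u
    2i≤u (inj₁ refl) = ≤-refl
    2i≤u (inj₂ refl) = n≤1+n _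
    2i≤m′ : 2 * i ≤ m′
    2i≤m′ = ≤-trans (2i≤u parity) (m∸n≤m m′ e)
    position : m′ ∸ e ≡ 2 * i ⊎ m′ ∸ e ≡ suc (2 * i) → 2 + e ≡ m ∸ 2 * i ⊎ 2 + e ≡ suc (m ∸ 2 * i)
    position (inj₁ q) = inj₂ (cong suc (sym (trans (cong (λ z → suc z ∸ 2 * i) (trans m′≡ (cong (e +_) q))) (m+n∸n≡m (suc e) (2 * i)))))
    position (inj₂ q) = inj₁ (sym (trans (cong (λ z → suc z ∸ 2 * i) (trans m′≡ (trans (cong (e +_) q) (+-suc e (2 * i))))) (m+n∸n≡m (2 + e) (2 * i))))

  representation : BarRep (K m (s * 2)) t
  representation = arrangement Q? root (λ _ → m′) (λ { {zero} {zero} _ → refl })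
    (≤-trans (≤-reflexive (+-identityʳ m)) (m≤n*m m t {{>-nonZero 1≤t}})) rare covered
    where
    rare : ∀ τ → ∃[ u ] Σ (ℕ → ℕ) λ pos → (∀ p → Q p τ → ∃[ i ] (i < u × pos i ≡ p)) × (u < t ⊎ u ≤ t × (∀ i → root i ≢ τ))
    rare zero    = 0 , (λ _ → 0) , (λ p (τ≢ , _) → ⊥-elim (τ≢ refl)) , inj₁ 1≤t
    rare (suc τ) = t , (λ i → m ∸ 2 * i) , (λ p (_ , q) → q) , inj₂ (≤-refl , λ _ ())

-- The outermost block encloses c bars. The copies go into the zones 2, …, m + 1, one for each residue
-- modulo m; that these zones exist is what long and first provide.
module Many-rows {m s′ t′ a′ c′ : ℕ} .{{_ : NonZero m}}
  (m≡ : m ≡ 2 * suc t′ + suc a′)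
  (short : suc c′ + s′ * suc a′ ≤ suc t′ * m)
  (start : suc a′ + 2 ≤ suc c′)
  (long : 1 ≤ s′ → suc m ≤ suc c′ + s′ * suc a′)
  (first : suc c′ ≡ m ⊎ suc c′ ≡ suc a′ + 2 × suc m ≤ suc c′ + s′ * suc a′) where

  private
    s t a c : ℕ
    s = suc s′
    t = suc t′
    a = suc a′
    c = suc c′

    -- The last bar touched by the block of `τ` is `g τ + 1`, so the residues left to the copies
    -- begin with that of `g τ + 2`.
    g : Fin s → ℕ
    g τ = c + a * toℕ τ

    -- The reduction modulo m is needed because the chain may end before the bar `g τ + 2`; the
    -- shift by 2 keeps to zones both of whose bars are drawn.
    pos : Fin s → ℕ → ℕ
    pos τ i = 2 + (g τ + 2 * i) % m

  Q : ℕ → Fin s → Set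
  Q p τ = ∃[ i ] (i < t′ × pos τ i ≡ p)

  sz : Fin s → ℕ
  sz zero    = c′
  sz (suc _) = a′

  blocks : List (Block (Fin m ⊎ Fin (s * 2)))
  blocks = hosts {m} {s} (λ τ → τ) sz

  size-blocks : size blocks ≡ c + s′ * a
  size-blocks = cong (c +_) (size-hosts {m} {s} suc a′)

  Covered : Fin m → Fin s → Set
  Covered x τ = ∃[ h ] (2 ≤ h × h mod m ≡ x ×
    ((∀ b → Touches blocks 0 (Y {m} {s} τ b) h) ⊎
     ∃[ p ] (1 ≤ p × p ≤ size blocks × Q p τ × (h ≡ p ⊎ h ≡ suc p))))

  -- Of the m successive residues from `2 + g τ` on, the copies meet the first 2t′, at their lower
  -- bars for even offsets and at their upper bars for odd ones. The other m - 2t′ = a + 2 are left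
  -- to the block, through the argument `host`.
  covered-late : ∀ x τ → suc m ≤ c + s′ * a → (∀ j → j < a + 2 → (2 + g τ + (2 * t′ + j)) mod m ≡ x → Covered x τ) → Covered x τ
  covered-late x τ wide host with residue (2 + g τ) x
  ... | e , e<m , eq with e <? 2 * t′
  ...   | no ¬p = host (e ∸ 2 * t′) (+-cancelˡ-< (2 * t′) _ _ (≤-trans (≤-reflexive (cong suc e≡)) (≤-trans e<m (≤-reflexive (trans m≡ (e₀ t′ a′))))))
            (trans (cong (λ z → (2 + g τ + z) mod m) e≡) eq)
    where
    e≡ : 2 * t′ + (e ∸ 2 * t′) ≡ e
    e≡ = m+[n∸m]≡n (≮⇒≥ ¬p)
    e₀ : ∀ t′ a′ → 2 * suc t′ + suc a′ ≡ 2 * t′ + (suc a′ + 2)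
    e₀ = solve-∀
  ...   | yes e<2t′ with halve e
  ...     | i , inj₁ refl = pos τ i , s≤s (s≤s z≤n) , trans (mod-+% 2 (g τ + 2 * i)) (trans (cong (_mod m) (e₀ (g τ) i)) eq) ,
              inj₂ (pos τ i , s≤s z≤n , within τ i , (i , *-cancelˡ-< 2 i t′ e<2t′ , refl) , inj₁ refl)
    where
    e₀ : ∀ g i → 2 + (g + 2 * i) ≡ 2 + g + 2 * i
    e₀ = solve-∀
    within : ∀ τ i → pos τ i ≤ size blocks
    within τ i = ≤-trans (s≤s (m%n<n (g τ + 2 * i) m)) (≤-trans wide (≤-reflexive (sym size-blocks)))
  ...     | i , inj₂ refl = suc (pos τ i) , s≤s (s≤s z≤n) , trans (mod-+% 3 (g τ + 2 * i)) (trans (cong (_mod m) (e₀ (g τ) i)) eq) ,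
              inj₂ (pos τ i , s≤s z≤n , within τ i , (i , *-cancelˡ-< 2 i t′ (<⇒≤ e<2t′) , refl) , inj₂ refl)
    where
    e₀ : ∀ g i → 3 + (g + 2 * i) ≡ 2 + g + suc (2 * i)
    e₀ = solve-∀
    within : ∀ τ i → pos τ i ≤ size blocks
    within τ i = ≤-trans (s≤s (m%n<n (g τ + 2 * i) m)) (≤-trans wide (≤-reflexive (sym size-blocks)))

  covered-first : ∀ x → c ≡ m ⊎ c ≡ a + 2 × suc m ≤ c + s′ * a → Covered x zero
  covered-first x (inj₁ c≡m) with residue 2 x
  ... | e , e<m , eq = 2 + e , s≤s (s≤s z≤n) , eq ,
        inj₁ (host-touch {m} {s} zero z≤n (s≤s (s≤s (≤-pred (≤-trans e<m (≤-reflexive (sym c≡m)))))))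
  covered-first x (inj₂ (c≡ , wide)) = covered-late x zero wide λ j j< eq →
    2 + j , s≤s (s≤s z≤n) , trans (sym (mod-+m (2 + j))) (trans (cong (_mod m) (sym (shape j))) eq) ,
    inj₁ (host-touch {m} {s} zero z≤n (s≤s (s≤s (≤-pred (≤-trans j< (≤-reflexive (sym c≡)))))))
    where
    e₀ : ∀ a t′ j → 2 + (suc a + 2 + suc a * 0) + (2 * t′ + j) ≡ 2 + j + (2 * suc t′ + suc a)
    e₀ = solve-∀
    shape : ∀ j → 2 + g zero + (2 * t′ + j) ≡ 2 + j + m
    shape j = trans (cong (λ z → 2 + (z + a * 0) + (2 * t′ + j)) c≡) (trans (e₀ a′ t′ j) (cong (2 + j +_) (sym m≡)))
  covered : ∀ x τ → Covered x τ
  covered x zero    = covered-first x first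
  covered x (suc σ) = covered-late x (suc σ) (long (≤-trans (s≤s z≤n) (Finₚ.toℕ<n σ))) λ j j< eq →
    -- Exactly one period m below `2 + g τ + 2t′ + j` is the bar `d + j`, and a block between the
    -- bars `d` and `d + 1` touches `d`, ..., `d + a + 1`.
    d + j , ≤-trans (≤-trans (m≤n+m 2 a) start) (≤-trans (m≤m+n c (a * toℕ σ)) (m≤m+n d j)) ,
    trans (sym (mod-+m (d + j))) (trans (cong (_mod m) (sym (shape j))) eq) ,
    inj₁ (λ b → there (later-touch {m} {s} suc a′ c σ (m≤m+n d j)
      (≤-trans (+-monoʳ-≤ d (≤-pred j<)) (≤-reflexive (e₁ d a′))) b))
    where
    d : ℕ
    d = c + a * toℕ σ
    e₀ : ∀ c a t′ σ j → 2 + (c + suc a * suc σ) + (2 * t′ + j) ≡ c + suc a * σ + j + (2 * suc t′ + suc a)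
    e₀ = solve-∀
    e₁ : ∀ d a′ → d + (a′ + 2) ≡ 2 + d + a′
    e₁ = solve-∀
    shape : ∀ j → 2 + g (suc σ) + (2 * t′ + j) ≡ d + j + m
    shape j = trans (e₀ c a′ t′ (toℕ σ) j) (cong (d + j +_) (sym m≡))

  representation : BarRep (K m (s * 2)) t
  representation = arrangement (λ p τ → anyUpTo? (λ i → pos τ i ≟ p) t′) (λ τ → τ) sz (λ eq → eq)
    (≤-trans (≤-reflexive size-blocks) short)
    (λ τ → t′ , pos τ , (λ p q → q) , inj₁ ≤-refl) covered

construction : ∀ m s t → 1 ≤ m → 1 ≤ s → m * s + 2 ≤ t * (m + 2 * s) → BarRep (K m (s * 2)) t
construction (suc m′) (suc s′) t _ _ enough with suc m′ ≤? 2 * t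
... | yes m≤2t = Few-rows.representation {s′ = s′} m≤2t
construction m@(suc m′) s@(suc s′) zero _ _ enough | no ¬p = ⊥-elim (<⇒≱ (≤-trans (s≤s z≤n) (m≤n+m 2 (m * s))) enough)
construction m@(suc m′) s@(suc s′) t@(suc t′) _ _ enough | no ¬p =
  build (m ∸ suc (2 * t)) (sym (trans (+-suc (2 * t) _) (m+[n∸m]≡n (≰⇒> ¬p))))
  where
  module Size (a′ : ℕ) (m≡ : m ≡ 2 * t + suc a′) where
    a : ℕ
    a = suc a′

    as+2≤tm : a * s + 2 ≤ t * m
    as+2≤tm = +-cancelˡ-≤ (2 * t * s) _ _ (begin
      2 * t * s + (a * s + 2)     ≡⟨ e₀ t a s ⟩
      (2 * t + a) * s + 2         ≡⟨ cong (λ z → z * s + 2) m≡ ⟨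
      m * s + 2                   ≤⟨ enough ⟩
      t * (m + 2 * s)             ≡⟨ e₁ t m s ⟩
      2 * t * s + t * m           ∎)
      where
      open ≤-Reasoning
      e₀ : ∀ t a s → 2 * t * s + (a * s + 2) ≡ (2 * t + a) * s + 2
      e₀ = solve-∀
      e₁ : ∀ t m s → t * (m + 2 * s) ≡ 2 * t * s + t * m
      e₁ = solve-∀

    reorder : ∀ a s′ → a * suc s′ + 2 ≡ a + 2 + s′ * a
    reorder = solve-∀

    -- When the outermost block takes m bars, the others must fit into t′ periods. For t = 1 the
    -- budget as + 2 ≤ m = a + 2 leaves no other block; for t ≥ 2 they fit into one period.
    later≤ : ∀ t′ → t ≡ suc t′ → a * s + 2 ≤ m → s′ * a ≤ t′ * m
    later≤ zero refl _ = ≤-trans (+-cancelˡ-≤ (a + 2) (s′ * a) 0 (begin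
      a + 2 + s′ * a              ≡⟨ reorder a s′ ⟨
      a * s + 2                   ≤⟨ as+2≤tm ⟩
      1 * m                       ≡⟨ trans (*-identityˡ m) m≡ ⟩
      2 + a                       ≡⟨ e₀ a ⟩
      a + 2 + 0                   ∎)) z≤n
      where
      open ≤-Reasoning
      e₀ : ∀ a → 2 + a ≡ a + 2 + 0
      e₀ = solve-∀
    later≤ (suc t″) refl as+2≤m = begin
      s′ * a                      ≤⟨ m≤n+m (s′ * a) (a + 2) ⟩
      a + 2 + s′ * a              ≡⟨ reorder a s′ ⟨
      a * s + 2                   ≤⟨ as+2≤m ⟩
      m                           ≤⟨ m≤m+n m (t″ * m) ⟩
      suc t″ * m                  ∎
      where open ≤-Reasoning

  build : ∀ a′ → m ≡ 2 * t + suc a′ → BarRep (K m (s * 2)) t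
  build a′ m≡ with suc m ≤? suc a′ * s + 2
  ... | yes wide = Many-rows.representation {s′ = s′} {c′ = a′ + 2} m≡ (≤-trans (≤-reflexive (sym (reorder a s′))) as+2≤tm) ≤-refl
          (λ _ → wide′) (inj₂ (refl , wide′))
    where
    open Size a′ m≡
    wide′ : suc m ≤ a + 2 + s′ * a
    wide′ = ≤-trans wide (≤-reflexive (reorder a s′))
  -- Blocks of `a` bars would not reach as far as zone m + 1, where copies may be placed. So the
  -- outermost block encloses m bars instead of a + 2, and its pair then meets all of X without
  -- copies.
  ... | no narrow = Many-rows.representation {s′ = s′} {c′ = m′} m≡ (+-monoʳ-≤ m (later≤ t′ refl as+2≤m))
          (≤-trans (+-monoˡ-≤ 2 (m≤m*n a s)) as+2≤m)
          (λ 1≤s′ → ≤-trans (≤-reflexive (+-comm 1 m)) (+-monoʳ-≤ m (*-mono-≤ 1≤s′ (s≤s z≤n)))) (inj₁ refl)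
    where
    open Size a′ m≡
    as+2≤m : a * s + 2 ≤ m
    as+2≤m = ≤-pred (≰⇒> narrow)

-- The ceiling and the final comparison

≤⌈/⌉* : ∀ a b .{{_ : NonZero b}} → a ≤ ⌈ a / b ⌉ * b
≤⌈/⌉* a b@(suc b′) = +-cancelʳ-≤ b′ _ _ (begin
  a + b′                                          ≡⟨ m≡m%n+[m/n]*n (a + b′) b ⟩
  (a + b′) % b + (a + b′) / b * b                 ≤⟨ +-monoˡ-≤ _ (≤-pred (m%n<n (a + b′) b)) ⟩
  b′ + (a + b′) / b * b                           ≡⟨ +-comm b′ _ ⟩
  (a + b′) / b * b + b′                           ∎)
  where open ≤-Reasoning

⌈/⌉≤ : ∀ a b .{{_ : NonZero b}} u → a ≤ u * b → ⌈ a / b ⌉ ≤ u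
⌈/⌉≤ a b@(suc b′) u a≤ub = ≤-pred (m<n*o⇒m/o<n (≤-trans (s≤s (+-monoˡ-≤ b′ a≤ub)) (≤-reflexive (e₀ u b′))))
  where
  e₀ : ∀ u b′ → suc (u * suc b′ + b′) ≡ suc u * suc b′
  e₀ = solve-∀

theorem13 : ∀ (m n : ℕ) → 1 ≤ m → 1 ≤ n → 2 ∣ n →
    BarVisibilityNumber (K m n) ⌈ m * n + 4 / 2 * m + 2 * n ⌉
theorem13 m@(suc m′) .(s * 2) 1≤m 1≤n (divides s refl) =
  construction m s _ 1≤m (*-cancelʳ-< 2 0 s 1≤n) (*-cancelˡ-≤ 2 (begin
    2 * (m * s + 2)                       ≡⟨ e₀ m s ⟩
    m * (s * 2) + 4                       ≤⟨ ≤⌈/⌉* (m * (s * 2) + 4) (2 * m + 2 * (s * 2)) ⟩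
    N * (2 * m + 2 * (s * 2))             ≡⟨ e₁ N m s ⟩
    2 * (N * (m + 2 * s))                 ∎)) ,
  λ u R → ⌈/⌉≤ (m * (s * 2) + 4) (2 * m + 2 * (s * 2)) u (lower u (edges-bound R 1≤m 1≤n))
  where
  open ≤-Reasoning
  N : ℕ
  N = ⌈ m * (s * 2) + 4 / 2 * m + 2 * (s * 2) ⌉
  e₀ : ∀ m s → 2 * (m * s + 2) ≡ m * (s * 2) + 4
  e₀ = solve-∀
  e₁ : ∀ N m s → N * (2 * m + 2 * (s * 2)) ≡ 2 * (N * (m + 2 * s))
  e₁ = solve-∀
  -- Both sides but for the 3 are even.
  lower : ∀ u → m * (s * 2) + 3 ≤ 2 * (u * (m + s * 2)) → m * (s * 2) + 4 ≤ u * (2 * m + 2 * (s * 2))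
  lower u h = begin
    m * (s * 2) + 4                       ≡⟨ e₀ m s ⟨
    2 * (m * s + 2)                       ≤⟨ *-monoʳ-≤ 2 (≤-trans (≤-reflexive (+-suc (m * s) 1))
                                               (*-cancelˡ-< 2 (m * s + 1) (u * (m + s * 2)) (≤-trans (≤-reflexive (e₂ m s)) h))) ⟩
    2 * (u * (m + s * 2))                 ≡⟨ e₃ u m s ⟩
    u * (2 * m + 2 * (s * 2))             ∎
    where
    e₂ : ∀ m s → suc (2 * (m * s + 1)) ≡ m * (s * 2) + 3
    e₂ = solve-∀
    e₃ : ∀ u m s → 2 * (u * (m + s * 2)) ≡ u * (2 * m + 2 * (s * 2))
    e₃ = solve-∀
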